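{- Let $\Phi$ be a reduced crystallographic root system with simple roots $\alpha_1,\dots,\alpha_n$, Weyl group $W$ and simple reflections $S=\{s_1,\dots,s_n\}$. Let $I\subseteq\{1,\dots,n\}$ be an arbitrary subset (the active set) and let $J=\{1,\dots,n\}\setminus I$ be its complement. Then there is a canonical bijection between the set of all configurations reachable in the Modified Kostant Game with active set $I$ and the set $W^J$ of minimal length representatives of the cosets $W/W_J$. Specifically: (1) a sequence $(k_1,\dots,k_m)$ of vertices is a valid firing sequence (starting from the zero configuration) if and only if $s_{k_m}s_{k_{m-1}}\cdots s_{k_1}$ is a reduced expression of an element of $W^J$; (2) sending the configuration reached by a valid firing sequence $(k_1,\dots,k_m)$ to the element $w=s_{k_m}\cdots s_{k_1}$ gives a well-defined bijection from the set of reachable configurations onto $W^J$.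
   Context: Let $E$ be a Euclidean space with inner product $\langle\cdot,\cdot\rangle$, $\Phi\subset E$ a reduced crystallographic root system with base $\alpha_1,\dots,\alpha_n$ and positive roots $\Phi^+$. For a root $\alpha$ put $\alpha^\vee=2\alpha/\langle\alpha,\alpha\rangle$. The Weyl group $W$ is generated by the simple reflections $s_i(\lambda)=\lambda-\langle\lambda,\alpha_i^\vee\rangle\alpha_i$; $\ell$ is the length function with respect to $S=\{s_1,\dots,s_n\}$, and an expression $s_{i_1}\cdots s_{i_k}$ is reduced if its length $k$ equals $\ell$ of the product. The inversion set of $w$ is $\mathcal I(w)=\Phi^+\cap w^{ -1}(-\Phi^+)$. Indices $i\in\{1,\dots,n\}$ are identified with simple reflections $s_i$ and with vertices of the Dynkin diagram. For $J\subseteq\{1,\dots,n\}$, $W_J$ is the subgroup generated by $\{s_j: j\in J\}$, $\Phi_J^+=\Phi^+\cap\mathrm{Span}_{\mathbb R}\{\alpha_j: j\in J\}$, and $W^J=\{w\in W:\mathcal I(w)\subseteq\Phi^+\setminus\Phi_J^+\}=\{w\in W:\ell(ws_j)>\ell(w)\text{ for all }j\in J\}$. Modified Kostant Game with active set $I$: a configuration is a vector $c=(c_1,\dots,c_n)\in\mathbb Z_{\ge0}^n$. For a vertex $v$, let $N(v)$ be the set of its neighbours in the Dynkin diagram, and for $u\in N(v)$ let $n_{v,u}=-\langle\alpha_u,\alpha_v^\vee\rangle$ (so $n_{v,u}=1$ if $\alpha_v$ is at least as long as $\alpha_u$, and $n_{v,u}\in\{2,3\}$, the number of edges joining $u$ and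 $v$, if $\alpha_v$ is shorter than $\alpha_u$). Let $\epsilon_v=1$ if $v\in I$ and $\epsilon_v=0$ otherwise. The vertex $v$ is sad in $c$ if $c_v<\tfrac12\left(\sum_{u\in N(v)}n_{v,u}c_u+\epsilon_v\right)$. A sad vertex $v$ may be fired; this replaces $c_v$ by $\sum_{u\in N(v)}n_{v,u}c_u+\epsilon_v-c_v$ and leaves all other entries unchanged. The game starts from $c^{(0)}=\mathbf 0$. A sequence $(k_1,\dots,k_m)$ of vertices is a valid firing sequence if, starting from $\mathbf 0$ and firing $k_1,\dots,k_m$ successively, each $k_j$ is sad at the moment it is fired. A configuration is reachable if it results from some (possibly empty) valid firing sequence. -}

module Defs where

open import Level using (Level; _⊔_; suc; 0ℓ)
open import Algebra.Bundles using (CommutativeRing)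
open import Algebra.Module.Bundles using (Module)
import Algebra.Definitions.RawMonoid as RawMonoidDefs
open import Data.Bool.Base using (if_then_else_)
open import Data.Fin.Base using (Fin)
import Data.Fin.Properties as Fin
open import Data.Fin.Subset using (Subset; _∉_)
open import Data.Fin.Subset.Properties using (_∈?_)
open import Data.Integer.Base as ℤ using (ℤ; +_; -[1+_]; 0ℤ; 1ℤ)
open import Data.List.Base using (List; []; _∷_; length; map; foldr; filter; allFin)
open import Data.Nat.Base as ℕ using (ℕ)
open import Data.Product.Base using (Σ; ∃; _×_; _,_; proj₁)
open import Data.Sum.Base using (_⊎_)
open import Data.Vec.Base using (Vec; lookup; replicate)
open import Relation.Binary.Bundles using (Setoid)
import Relation.Binary.Construct.On as On
open import Relation.Binary.Core using (Rel)
open import Relation.Binary.PropositionalEquality using (_≡_; _≢_)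
import Relation.Binary.PropositionalEquality as ≡
open import Relation.Binary.Structures using (IsStrictTotalOrder)
open import Relation.Nullary using (¬_; Dec; does; ¬?; _×-dec_)

-- The scalars are an arbitrary ordered field, in place of ℝ. The value of
-- _⁻¹ at zero is unconstrained, and _⁻¹ is only ever used at ⟪ α , α ⟫ for a
-- root α.
record OrderedField (c ℓ₁ ℓ₂ : Level) : Set (suc (c ⊔ ℓ₁ ⊔ ℓ₂)) where
  infix 4 _<_
  infix 8 _⁻¹
  field
    commutativeRing : CommutativeRing c ℓ₁
  open CommutativeRing commutativeRing public
  field
    _<_                : Rel Carrier ℓ₂
    _⁻¹                : Carrier → Carrier
    isStrictTotalOrder : IsStrictTotalOrder _≈_ _<_
    1≉0                : 1# ≉ 0#
    ⁻¹-inverse         : ∀ x → x ≉ 0# → x * x ⁻¹ ≈ 1#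
    +-mono-<           : ∀ {x y} z → x < y → x + z < y + z
    *-pos              : ∀ {x y} → 0# < x → 0# < y → 0# < x * y

  open IsStrictTotalOrder isStrictTotalOrder public using (_≟_)

  private module Mult = RawMonoidDefs +-rawMonoid

  fromℤ : ℤ → Carrier
  fromℤ (+ n)    = n Mult.× 1#
  fromℤ -[1+ n ] = - (ℕ.suc n Mult.× 1#)

-- An inner product space. Finite-dimensionality is not a field, because below
-- the space is always spanned by a finite root system.
record EuclideanSpace {c ℓ₁ ℓ₂} (K : OrderedField c ℓ₁ ℓ₂) (e ℓ : Level)
       : Set (c ⊔ ℓ₁ ⊔ ℓ₂ ⊔ suc (e ⊔ ℓ)) where
  open OrderedField K
  field
    vectorSpace : Module commutativeRing e ℓ
  open Module vectorSpace public
  field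
    ⟪_,_⟫             : Carrierᴹ → Carrierᴹ → Carrier
    ⟪⟫-cong           : ∀ {x x′ y y′} → x ≈ᴹ x′ → y ≈ᴹ y′ → ⟪ x , y ⟫ ≈ ⟪ x′ , y′ ⟫
    ⟪⟫-sym            : ∀ x y → ⟪ x , y ⟫ ≈ ⟪ y , x ⟫
    ⟪⟫-+ˡ             : ∀ x y z → ⟪ x +ᴹ y , z ⟫ ≈ ⟪ x , z ⟫ + ⟪ y , z ⟫
    ⟪⟫-*ˡ             : ∀ k x y → ⟪ k *ₗ x , y ⟫ ≈ k * ⟪ x , y ⟫
    positive-definite : ∀ x → x ≉ᴹ 0ᴹ → 0# < ⟪ x , x ⟫

  private module Sum = RawMonoidDefs +ᴹ-rawMonoid

  linComb : ∀ {k} → (Fin k → Carrier) → (Fin k → Carrierᴹ) → Carrierᴹ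
  linComb a v = Sum.sum (λ i → a i *ₗ v i)

  infix 9 _^∨
  _^∨ : Carrierᴹ → Carrierᴹ
  α ^∨ = ((1# + 1#) * ⟪ α , α ⟫ ⁻¹) *ₗ α

  reflect : Carrierᴹ → Carrierᴹ → Carrierᴹ
  reflect α x = x +ᴹ -ᴹ (⟪ x , α ^∨ ⟫ *ₗ α)

-- The finite set Φ is given by an enumeration, possibly with repetitions.
record RootSystem {c ℓ₁ ℓ₂ e ℓ} {K : OrderedField c ℓ₁ ℓ₂} (E : EuclideanSpace K e ℓ)
       : Set (c ⊔ ℓ₁ ⊔ ℓ₂ ⊔ e ⊔ ℓ) where
  open OrderedField K
  open EuclideanSpace E
  field
    size : ℕ
    root : Fin size → Carrierᴹ

  infix 4 _∈Φ
  _∈Φ : Carrierᴹ → Set ℓ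
  β ∈Φ = ∃ λ i → β ≈ᴹ root i

  field
    nonzero  : ∀ {α} → α ∈Φ → α ≉ᴹ 0ᴹ
    spanning : ∀ x → ∃ λ a → x ≈ᴹ linComb a root
    closed   : ∀ {α β} → α ∈Φ → β ∈Φ → reflect α β ∈Φ
    integral : ∀ {α β} → α ∈Φ → β ∈Φ → ∃ λ z → ⟪ β , α ^∨ ⟫ ≈ fromℤ z
    reduced  : ∀ {α} k → α ∈Φ → (k *ₗ α) ∈Φ → k ≈ 1# ⊎ k ≈ - 1#

-- The simple roots span E because the roots do.
record Base {c ℓ₁ ℓ₂ e ℓ} {K : OrderedField c ℓ₁ ℓ₂} {E : EuclideanSpace K e ℓ}
       (Φ : RootSystem E) (n : ℕ) : Set (c ⊔ ℓ₁ ⊔ ℓ₂ ⊔ e ⊔ ℓ) where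
  open OrderedField K
  open EuclideanSpace E
  open RootSystem Φ
  field
    simple        : Fin n → Carrierᴹ
    simple∈Φ      : ∀ i → simple i ∈Φ
    independent   : ∀ a → linComb a simple ≈ᴹ 0ᴹ → ∀ i → a i ≈ 0#
    decomposition : ∀ {β} → β ∈Φ → ∃ λ (z : Fin n → ℤ) →
      β ≈ᴹ linComb (λ i → fromℤ (z i)) simple ×
      ((∀ i → 0ℤ ℤ.≤ z i) ⊎ (∀ i → z i ℤ.≤ 0ℤ))

module WeylGroup {c ℓ₁ ℓ₂ e ℓ} {K : OrderedField c ℓ₁ ℓ₂} {E : EuclideanSpace K e ℓ}
                 (Φ : RootSystem E) {n : ℕ} (B : Base Φ n) where
  open OrderedField K
  open EuclideanSpace E
  open RootSystem Φ
  open Base B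

  infix 4 _∈Φ⁺ _∈Φ⁺[_] _≈ᵂ_ _∈W^_

  _∈Φ⁺ : Carrierᴹ → Set ℓ
  β ∈Φ⁺ = β ∈Φ × ∃ λ (z : Fin n → ℤ) →
    (∀ i → 0ℤ ℤ.≤ z i) × β ≈ᴹ linComb (λ i → fromℤ (z i)) simple

  _∈Φ⁺[_] : Carrierᴹ → Subset n → Set (c ⊔ ℓ₁ ⊔ ℓ)
  β ∈Φ⁺[ J ] = β ∈Φ⁺ × ∃ λ (a : Fin n → Carrier) →
    (∀ j → j ∉ J → a j ≈ 0#) × β ≈ᴹ linComb a simple

  Word : Set
  Word = List (Fin n)

  -- ⟦ i₁ ∷ ⋯ ∷ iₖ ∷ [] ⟧ is s_{i₁} ∘ ⋯ ∘ s_{iₖ}.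
  ⟦_⟧ : Word → Carrierᴹ → Carrierᴹ
  ⟦ [] ⟧     x = x
  ⟦ i ∷ is ⟧ x = reflect (simple i) (⟦ is ⟧ x)

  -- Simple reflections are involutions, so the group they generate consists
  -- of the maps that are products of them.
  record Weyl : Set (e ⊔ ℓ) where
    field
      apply     : Carrierᴹ → Carrierᴹ
      generated : ∃ λ (is : Word) → ∀ x → apply x ≈ᴹ ⟦ is ⟧ x

  open Weyl public

  _≈ᵂ_ : Rel Weyl (e ⊔ ℓ)
  w ≈ᵂ w′ = ∀ x → apply w x ≈ᴹ apply w′ x

  weylSetoid : Setoid (e ⊔ ℓ) (e ⊔ ℓ)
  weylSetoid = record
    { Carrier       = Weyl
    ; _≈_           = _≈ᵂ_
    ; isEquivalence = record
      { refl  = λ _ → ≈ᴹ-refl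
      ; sym   = λ p x → ≈ᴹ-sym (p x)
      ; trans = λ p q x → ≈ᴹ-trans (p x) (q x)
      }
    }

  product : Word → Weyl
  product is = record { apply = ⟦ is ⟧ ; generated = is , λ _ → ≈ᴹ-refl }

  -- IsLength w k says ℓ(w) = k.
  IsLength : Weyl → ℕ → Set (e ⊔ ℓ)
  IsLength w k =
    (∃ λ is → w ≈ᵂ product is × length is ≡ k) ×
    (∀ is → w ≈ᵂ product is → k ℕ.≤ length is)

  Reduced : Word → Set (e ⊔ ℓ)
  Reduced is = IsLength (product is) (length is)

  Inversion : Weyl → Carrierᴹ → Set ℓ
  Inversion w β = β ∈Φ⁺ × (-ᴹ apply w β) ∈Φ⁺

  _∈W^_ : Weyl → Subset n → Set (c ⊔ ℓ₁ ⊔ e ⊔ ℓ)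
  w ∈W^ J = ∀ β → Inversion w β → β ∈Φ⁺ × ¬ β ∈Φ⁺[ J ]

  W^-setoid : Subset n → Setoid (c ⊔ ℓ₁ ⊔ e ⊔ ℓ) (e ⊔ ℓ)
  W^-setoid J = On.setoid {B = Σ Weyl (_∈W^ J)} weylSetoid proj₁

module KostantGame {c ℓ₁ ℓ₂ e ℓ} {K : OrderedField c ℓ₁ ℓ₂} {E : EuclideanSpace K e ℓ}
                   (Φ : RootSystem E) {n : ℕ} (B : Base Φ n) (I : Subset n) where
  open OrderedField K using (0#; _≉_; _≟_)
  open EuclideanSpace E
  open RootSystem Φ
  open Base B

  -- n_{v,u} = - ⟨ α_u , α_v^∨ ⟩
  multiplicity : Fin n → Fin n → ℤ
  multiplicity v u = ℤ.- proj₁ (integral (simple∈Φ v) (simple∈Φ u))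

  Neighbour : Fin n → Fin n → Set ℓ₁
  Neighbour v u = v ≢ u × ⟪ simple v , simple u ⟫ ≉ 0#

  neighbour? : ∀ v u → Dec (Neighbour v u)
  neighbour? v u = ¬? (v Fin.≟ u) ×-dec ¬? (⟪ simple v , simple u ⟫ ≟ 0#)

  neighbours : Fin n → List (Fin n)
  neighbours v = filter (neighbour? v) (allFin n)

  ε : Fin n → ℤ
  ε v = if does (v ∈? I) then 1ℤ else 0ℤ

  Config : Set
  Config = Vec ℕ n

  𝟎 : Config
  𝟎 = replicate n 0

  -- ∑_{u ∈ N(v)} n_{v,u} c_u + ε_v
  surround : Config → Fin n → ℤ
  surround c v =
    foldr ℤ._+_ 0ℤ (map (λ u → multiplicity v u ℤ.* + lookup c u) (neighbours v)) ℤ.+ ε v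

  Sad : Config → Fin n → Set
  Sad c v = + 2 ℤ.* + lookup c v ℤ.< surround c v

  -- Firing is a relation, so that the new entry can be prescribed in ℤ while
  -- entries stay in ℕ. At a sad vertex the prescribed value is nonnegative.
  record Fires (c : Config) (v : Fin n) (c′ : Config) : Set where
    field
      sad    : Sad c v
      fired  : + lookup c′ v ≡ surround c v ℤ.- + lookup c v
      others : ∀ u → u ≢ v → lookup c′ u ≡ lookup c u

  -- The head of the list is fired first.
  data Run (c : Config) : List (Fin n) → Config → Set where
    []  : Run c [] c
    _∷_ : ∀ {k ks c′ c″} → Fires c k c′ → Run c′ ks c″ → Run c (k ∷ ks) c″

  Valid : List (Fin n) → Set
  Valid ks = ∃ λ c → Run 𝟎 ks c

  Reachable : Config → Set
  Reachable c = ∃ λ ks → Run 𝟎 ks c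

  reachableSetoid : Setoid 0ℓ 0ℓ
  reachableSetoid = On.setoid {B = Σ Config Reachable} (≡.setoid Config) proj₁

{-# OPTIONS --safe #-}

module Submission where

open import Algebra.Bundles using (CommutativeMonoid; CommutativeRing)
import Algebra.Properties.CommutativeMonoid.Sum as MonoidSum
import Algebra.Properties.CommutativeSemigroup as CommutativeSemigroupProperties
import Algebra.Properties.Group as GroupProperties
import Algebra.Properties.Ring as RingProperties
import Algebra.Properties.Semiring.Mult.TCOptimised as SemiringMult
import Algebra.Properties.Semiring.Sum as SemiringSum
import Algebra.Solver.Ring as RingSolver
open import Algebra.Solver.Ring.AlmostCommutativeRing using (_-Raw-AlmostCommutative⟶_; fromCommutativeRing)
open import Data.Fin.Base using (Fin; zero; suc)
import Data.Fin.Properties as Fin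
open import Data.Fin.Subset using (Subset; ∁; _∈_; _∉_)
open import Data.Fin.Subset.Properties using (_∈?_; x∈p⇒x∉∁p; x∉∁p⇒x∈p)
open import Data.Integer.Base as ℤ using (ℤ; +_; -[1+_]; 0ℤ; 1ℤ)
import Data.Integer.Properties as ℤ
import Data.Integer.Solver as ℤSolver
open import Data.List.Base using (List; []; _∷_; length; reverse; _ʳ++_; map; foldr; filter; tabulate)
open import Data.List.Properties using (reverse-involutive)
import Data.Maybe.Base as Maybe
open import Data.Nat.Base as ℕ using (ℕ; zero; suc; z≤n; s≤s)
import Data.Nat.Properties as ℕ
open import Data.Product.Base using (Σ; ∃; _×_; _,_; proj₁; proj₂)
open import Data.Sum.Base using (_⊎_; inj₁; inj₂; [_,_]′)
open import Data.Unit.Polymorphic.Base using (⊤; tt)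
open import Data.Vec.Base using (lookup; _[_]≔_)
open import Data.Vec.Properties using (lookup∘update; lookup∘update′; lookup-replicate; tabulate∘lookup; tabulate-cong)
open import Defs
open import Function.Base using (_∘_)
open import Function.Bundles using (_⇔_; mk⇔; Bijection; module Equivalence)
open import Level using (_⊔_)
open import Relation.Binary.Definitions using (tri<; tri≈; tri>)
open import Relation.Binary.PropositionalEquality as ≡ using (_≡_; _≢_)
import Relation.Binary.Reasoning.Setoid as SetoidReasoning
open import Relation.Binary.Structures using (IsStrictTotalOrder)
open import Relation.Nullary using (¬_; Dec; yes; no; contradiction)
open import Relation.Nullary.Decidable using (dec⇒maybe)

-- Let ρ satisfy ⟨ρ , αᵥ^∨⟩ = εᵥ, and encode a configuration c as the vector
-- μ = ρ - ∑ cᵥ αᵥ. Then v is sad iff ⟨μ , αᵥ⟩ > 0, and firing v replaces μ by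
-- sᵥ μ. After firing k₁, …, kₘ the vector is therefore w ρ for
-- w = s_{kₘ} ⋯ s_{k₁}, and v is sad iff ⟨ρ , w⁻¹ αᵥ⟩ > 0, that is, iff w⁻¹ αᵥ is
-- a positive root outside Φ_J. Such a step adds exactly the inversion w⁻¹ αᵥ, so
-- it keeps the expression reduced and the element in W^J; conversely, every
-- step of a reduced expression of an element of W^J, read from the right, has
-- this form.
-- Finally w ρ determines c, since the simple roots are independent, and it
-- determines w ∈ W^J: if w = sᵥ w′ and u ρ = w ρ with u ∈ W^J, then
-- ⟨ρ , u⁻¹ αᵥ⟩ < 0, so sᵥ u ∈ W^J, and one concludes by induction on ℓ(w).
-- The vector ρ enters only through the functional F x = 2⟨ρ , x⟩.

-- The homomorphism from ℤ to a commutative ring, and ring solving with integer coefficients.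

module IntegerCoefficients {c ℓ} (R : CommutativeRing c ℓ) where
  open CommutativeRing R
  open SetoidReasoning setoid
  open RingProperties ring
  open SemiringMult semiring using (×1-homo-*) renaming (_×_ to _×′_; 1+× to 1+×′; ×-homo-+ to ×′-homo-+)

  -- The type-checking optimised multiple makes ι 1 and ι 2 reduce to 1# and 1# + 1#.
  ι : ℤ → Carrier
  ι (+ n)    = n ×′ 1#
  ι -[1+ n ] = - (suc n ×′ 1#)

  -- Integer addition with mixed signs computes by `⊖`, so this is the mixed case of `ι-+`.
  ι-⊖ : ∀ m n → ι (m ℤ.⊖ n) ≈ m ×′ 1# - n ×′ 1#
  ι-⊖ m zero = sym (trans (+-congˡ -0#≈0#) (+-identityʳ _))
  ι-⊖ zero (suc n) = sym (+-identityˡ _)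
  ι-⊖ (suc m) (suc n) = begin
    ι (suc m ℤ.⊖ suc n)              ≡⟨ ≡.cong ι (ℤ.[1+m]⊖[1+n]≡m⊖n m n) ⟩
    ι (m ℤ.⊖ n)                      ≈⟨ ι-⊖ m n ⟩
    m ×′ 1# - n ×′ 1#                ≈⟨ +-identityˡ _ ⟨
    0# + (m ×′ 1# - n ×′ 1#)         ≈⟨ +-congʳ (-‿inverseʳ 1#) ⟨
    (1# - 1#) + (m ×′ 1# - n ×′ 1#)  ≈⟨ +-assoc _ _ _ ⟩
    1# + (- 1# + (m ×′ 1# - n ×′ 1#))
      ≈⟨ +-congˡ (trans (sym (+-assoc _ _ _)) (trans (+-congʳ (+-comm _ _)) (+-assoc _ _ _))) ⟩
    1# + (m ×′ 1# + (- 1# - n ×′ 1#)) ≈⟨ +-assoc _ _ _ ⟨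
    (1# + m ×′ 1#) + (- 1# - n ×′ 1#)
      ≈⟨ +-cong (sym (1+×′ m 1#)) (trans (-‿+-comm _ _) (-‿cong (sym (1+×′ n 1#)))) ⟩
    suc m ×′ 1# - suc n ×′ 1#        ∎

  ι-+ : ∀ i j → ι (i ℤ.+ j) ≈ ι i + ι j
  ι-+ (+ m) (+ n) = ×′-homo-+ 1# m n
  ι-+ (+ m) -[1+ n ] = ι-⊖ m (suc n)
  ι-+ -[1+ m ] (+ n) = trans (ι-⊖ n (suc m)) (+-comm _ _)
  ι-+ -[1+ m ] -[1+ n ] = begin
    - (suc (suc (m ℕ.+ n)) ×′ 1#)    ≡⟨ ≡.cong (λ k → - (suc k ×′ 1#)) (≡.sym (ℕ.+-suc m n)) ⟩
    - ((suc m ℕ.+ suc n) ×′ 1#)      ≈⟨ -‿cong (×′-homo-+ 1# (suc m) (suc n)) ⟩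
    - (suc m ×′ 1# + suc n ×′ 1#)    ≈⟨ -‿+-comm _ _ ⟨
    - (suc m ×′ 1#) - suc n ×′ 1#    ∎

  ι-neg : ∀ i → ι (ℤ.- i) ≈ - ι i
  ι-neg (+ zero)  = sym -0#≈0#
  ι-neg (+ suc n) = refl
  ι-neg -[1+ n ]  = sym (-‿involutive _)

  ι-+* : ∀ m j → ι (+ m ℤ.* j) ≈ ι (+ m) * ι j
  ι-+* m (+ n) = begin
    ι (+ m ℤ.* + n)    ≡⟨ ≡.cong ι (ℤ.pos-* m n) ⟨
    (m ℕ.* n) ×′ 1#    ≈⟨ ×1-homo-* m n ⟩
    m ×′ 1# * n ×′ 1#  ∎
  ι-+* m -[1+ n ] = begin
    ι (+ m ℤ.* ℤ.- (+ suc n))  ≡⟨ ≡.cong ι (ℤ.neg-distribʳ-* (+ m) (+ suc n)) ⟨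
    ι (ℤ.- (+ m ℤ.* + suc n))  ≈⟨ ι-neg (+ m ℤ.* + suc n) ⟩
    - ι (+ m ℤ.* + suc n)      ≈⟨ -‿cong (ι-+* m (+ suc n)) ⟩
    - (ι (+ m) * ι (+ suc n))  ≈⟨ -‿distribʳ-* _ _ ⟩
    ι (+ m) * ι -[1+ n ]       ∎

  ι-* : ∀ i j → ι (i ℤ.* j) ≈ ι i * ι j
  ι-* (+ m) j = ι-+* m j
  ι-* -[1+ m ] j = begin
    ι (ℤ.- (+ suc m) ℤ.* j)  ≡⟨ ≡.cong ι (ℤ.neg-distribˡ-* (+ suc m) j) ⟨
    ι (ℤ.- (+ suc m ℤ.* j))  ≈⟨ ι-neg (+ suc m ℤ.* j) ⟩
    - ι (+ suc m ℤ.* j)      ≈⟨ -‿cong (ι-+* (suc m) j) ⟩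
    - (ι (+ suc m) * ι j)    ≈⟨ -‿distribˡ-* _ _ ⟩
    ι -[1+ m ] * ι j         ∎

  ι-morphism : ℤ.+-*-rawRing -Raw-AlmostCommutative⟶ fromCommutativeRing R
  ι-morphism = record
    { ⟦_⟧    = ι
    ; +-homo = ι-+
    ; *-homo = ι-*
    ; -‿homo = ι-neg
    ; 0-homo = refl
    ; 1-homo = refl
    }

  -- Coefficients lie in ℤ because its decidable equality lets the solver detect cancellation.
  module Solver = RingSolver ℤ.+-*-rawRing (fromCommutativeRing R) ι-morphism
    (λ i j → Maybe.map (reflexive ∘ ≡.cong ι) (dec⇒maybe (i ℤ.≟ j)))

-- Finite sums in a commutative ring.

module FiniteSums {c ℓ} (R : CommutativeRing c ℓ) where
  open CommutativeRing R hiding (zero)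
  open MonoidSum +-commutativeMonoid public using (sum; sum-cong-≋; ∑-distrib-+)
  open SemiringSum semiring public using (*-distribˡ-sum)
  open IntegerCoefficients R using (module Solver)
  open Solver using (solve; _:=_; _:+_)
  open SetoidReasoning setoid

  sum-zero : ∀ {k} {t : Fin k → Carrier} → (∀ i → t i ≈ 0#) → sum t ≈ 0#
  sum-zero {zero}  t≈0 = refl
  sum-zero {suc k} t≈0 = trans (+-cong (t≈0 zero) (sum-zero (t≈0 ∘ suc))) (+-identityˡ 0#)

  -- Tracks a change in a single term, as when a vertex fires. Adding the two entries crosswise
  -- avoids subtraction.
  sum-update : ∀ {k} (s t : Fin k → Carrier) i → (∀ j → j ≢ i → s j ≈ t j) →
               sum s + t i ≈ sum t + s i
  sum-update s t zero s≈t = begin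
    (s zero + sum (s ∘ suc)) + t zero  ≈⟨ +-congʳ (+-congˡ (sum-cong-≋ λ j → s≈t (suc j) λ ())) ⟩
    (s zero + sum (t ∘ suc)) + t zero  ≈⟨ solve 3 (λ a b c → (a :+ b) :+ c := (c :+ b) :+ a) refl _ _ _ ⟩
    (t zero + sum (t ∘ suc)) + s zero  ∎
  sum-update s t (suc i) s≈t = begin
    (s zero + sum (s ∘ suc)) + t (suc i)  ≈⟨ +-assoc _ _ _ ⟩
    s zero + (sum (s ∘ suc) + t (suc i))
      ≈⟨ +-cong (s≈t zero λ ()) (sum-update (s ∘ suc) (t ∘ suc) i λ j j≢i → s≈t (suc j) λ { ≡.refl → j≢i ≡.refl }) ⟩
    t zero + (sum (t ∘ suc) + s (suc i))  ≈⟨ +-assoc _ _ _ ⟨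
    (t zero + sum (t ∘ suc)) + s (suc i)  ∎

  sum-single : ∀ {k} (t : Fin k → Carrier) i → (∀ j → j ≢ i → t j ≈ 0#) → sum t ≈ t i
  sum-single {k} t i t≈0 = begin
    sum t            ≈⟨ +-identityʳ _ ⟨
    sum t + 0#       ≈⟨ sum-update t zeros i t≈0 ⟩
    sum zeros + t i  ≈⟨ +-congʳ (sum-zero {t = zeros} λ _ → refl) ⟩
    0# + t i         ≈⟨ +-identityˡ _ ⟩
    t i              ∎
    where
    zeros : Fin k → Carrier
    zeros _ = 0#

-- Sign rules in an ordered field, and the embedding of ℤ.

module OrderedFieldProperties {c ℓ₁ ℓ₂} (K : OrderedField c ℓ₁ ℓ₂) where
  open OrderedField K hiding (zero)
  open IsStrictTotalOrder isStrictTotalOrder using (compare; <-resp-≈; irrefl) renaming (trans to <-trans)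
  open IntegerCoefficients commutativeRing
  open Solver using (solve; _:=_; :-_; _:*_; con)
  open FiniteSums commutativeRing
  open SemiringMult semiring using (×ᵤ≈×)
  open RingProperties ring
  open SetoidReasoning setoid

  infix 4 0≤_
  0≤_ : Carrier → Set _
  0≤ x = 0# < x ⊎ 0# ≈ x

  <-respʳ : ∀ {x y z} → y ≈ z → x < y → x < z
  <-respʳ = proj₁ <-resp-≈

  <-respˡ : ∀ {x y z} → y ≈ z → y < x → z < x
  <-respˡ = proj₂ <-resp-≈

  0≤-resp : ∀ {x y} → x ≈ y → 0≤ x → 0≤ y
  0≤-resp x≈y (inj₁ 0<x) = inj₁ (<-respʳ x≈y 0<x)
  0≤-resp x≈y (inj₂ 0≈x) = inj₂ (trans 0≈x x≈y)

  neg⇒0<- : ∀ {x} → x < 0# → 0# < - x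
  neg⇒0<- {x} x<0 = <-respˡ (-‿inverseʳ x) (<-respʳ (+-identityˡ _) (+-mono-< (- x) x<0))

  0<-⇒≮ : ∀ {x} → 0# < - x → ¬ 0# < x
  0<-⇒≮ {x} 0<-x 0<x = irrefl refl
    (<-trans 0<x (<-respˡ (+-identityˡ x) (<-respʳ (-‿inverseˡ x) (+-mono-< x 0<-x))))

  0<1 : 0# < 1#
  0<1 with compare 0# 1#
  ... | tri< 0<1 _ _ = 0<1
  ... | tri≈ _ 0≈1 _ = contradiction (sym 0≈1) 1≉0
  -- If `1#` were negative, the square of `- 1#`, which is `1#`, would be positive.
  ... | tri> _ _ 1<0 = contradiction
    (<-respʳ (solve 0 (:- con 1ℤ :* :- con 1ℤ := con 1ℤ) refl) (*-pos (neg⇒0<- 1<0) (neg⇒0<- 1<0)))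
    (0<-⇒≮ (neg⇒0<- 1<0))

  0<⇒≉0 : ∀ {x} → 0# < x → x ≉ 0#
  0<⇒≉0 0<x x≈0 = irrefl (sym x≈0) 0<x

  0≤∧≮⇒≈0 : ∀ {x} → 0≤ x → ¬ 0# < x → x ≈ 0#
  0≤∧≮⇒≈0 (inj₁ 0<x) 0≮x = contradiction 0<x 0≮x
  0≤∧≮⇒≈0 (inj₂ 0≈x) _   = sym 0≈x

  0≤-⇒≮ : ∀ {x} → 0≤ - x → ¬ 0# < x
  0≤-⇒≮ (inj₁ 0<-x) = 0<-⇒≮ 0<-x
  0≤-⇒≮ (inj₂ 0≈-x) 0<x = 0<⇒≉0 0<x (trans (sym (-‿involutive _)) (trans (-‿cong (sym 0≈-x)) -0#≈0#))

  pos-+-nonneg : ∀ {x y} → 0# < x → 0≤ y → 0# < x + y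
  pos-+-nonneg {x} {y} 0<x (inj₁ 0<y) = <-trans 0<y (<-respˡ (+-identityˡ y) (+-mono-< y 0<x))
  pos-+-nonneg 0<x (inj₂ 0≈y) = <-respʳ (trans (sym (+-identityʳ _)) (+-congˡ 0≈y)) 0<x

  nonneg-+-pos : ∀ {x y} → 0≤ x → 0# < y → 0# < x + y
  nonneg-+-pos 0≤x 0<y = <-respʳ (+-comm _ _) (pos-+-nonneg 0<y 0≤x)

  nonneg-+ : ∀ {x y} → 0≤ x → 0≤ y → 0≤ x + y
  nonneg-+ (inj₁ 0<x) 0≤y = inj₁ (pos-+-nonneg 0<x 0≤y)
  nonneg-+ (inj₂ 0≈x) 0≤y = 0≤-resp (trans (sym (+-identityˡ _)) (+-congʳ 0≈x)) 0≤y

  nonneg-* : ∀ {x y} → 0≤ x → 0≤ y → 0≤ x * y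
  nonneg-* (inj₁ 0<x) (inj₁ 0<y) = inj₁ (*-pos 0<x 0<y)
  nonneg-* (inj₁ 0<x) (inj₂ 0≈y) = inj₂ (trans (sym (zeroʳ _)) (*-congˡ 0≈y))
  nonneg-* (inj₂ 0≈x) _          = inj₂ (trans (sym (zeroˡ _)) (*-congʳ 0≈x))

  pos-*-cancelˡ : ∀ {x y} → 0# < x → 0# < x * y → 0# < y
  pos-*-cancelˡ {x} {y} 0<x 0<xy with compare 0# y
  ... | tri< 0<y _ _ = 0<y
  ... | tri≈ _ 0≈y _ = contradiction (trans (*-congˡ (sym 0≈y)) (zeroʳ x)) (0<⇒≉0 0<xy)
  ... | tri> _ _ y<0 = contradiction 0<xy
    (0<-⇒≮ (<-respʳ (sym (-‿distribʳ-* x y)) (*-pos 0<x (neg⇒0<- y<0))))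

  sum-nonneg : ∀ {k} {t : Fin k → Carrier} → (∀ i → 0≤ t i) → 0≤ sum t
  sum-nonneg {zero}  0≤t = inj₂ refl
  sum-nonneg {suc k} 0≤t = nonneg-+ (0≤t zero) (sum-nonneg (0≤t ∘ suc))

  sum-pos : ∀ {k} {t : Fin k → Carrier} → (∀ i → 0≤ t i) → ∀ i → 0# < t i → 0# < sum t
  sum-pos 0≤t zero    0<tᵢ = pos-+-nonneg 0<tᵢ (sum-nonneg (0≤t ∘ suc))
  sum-pos 0≤t (suc i) 0<tᵢ = nonneg-+-pos (0≤t zero) (sum-pos (0≤t ∘ suc) i 0<tᵢ)

  -- Congruence of `_⁻¹` comes from the uniqueness of inverses, hence only away from zero.
  ⁻¹-cong : ∀ {x y} → x ≉ 0# → x ≈ y → x ⁻¹ ≈ y ⁻¹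
  ⁻¹-cong {x} {y} x≉0 x≈y = begin
    x ⁻¹                ≈⟨ *-identityʳ _ ⟨
    x ⁻¹ * 1#           ≈⟨ *-congˡ (⁻¹-inverse y (x≉0 ∘ trans x≈y)) ⟨
    x ⁻¹ * (y * y ⁻¹)   ≈⟨ *-congˡ (*-congʳ (sym x≈y)) ⟩
    x ⁻¹ * (x * y ⁻¹)   ≈⟨ solve 3 (λ a b c → a :* (b :* c) := (b :* a) :* c) refl _ _ _ ⟩
    (x * x ⁻¹) * y ⁻¹   ≈⟨ *-congʳ (⁻¹-inverse x x≉0) ⟩
    1# * y ⁻¹           ≈⟨ *-identityˡ _ ⟩
    y ⁻¹                ∎

  -- `ι` uses the optimised multiple and `fromℤ` the plain one; this carries the homomorphism laws
  -- of `ι` over to `fromℤ`.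
  fromℤ≈ι : ∀ i → fromℤ i ≈ ι i
  fromℤ≈ι (+ n)    = ×ᵤ≈× n 1#
  fromℤ≈ι -[1+ n ] = -‿cong (×ᵤ≈× (suc n) 1#)

  fromℤ-+ : ∀ i j → fromℤ (i ℤ.+ j) ≈ fromℤ i + fromℤ j
  fromℤ-+ i j = trans (fromℤ≈ι (i ℤ.+ j)) (trans (ι-+ i j) (+-cong (sym (fromℤ≈ι i)) (sym (fromℤ≈ι j))))

  fromℤ-* : ∀ i j → fromℤ (i ℤ.* j) ≈ fromℤ i * fromℤ j
  fromℤ-* i j = trans (fromℤ≈ι (i ℤ.* j)) (trans (ι-* i j) (*-cong (sym (fromℤ≈ι i)) (sym (fromℤ≈ι j))))

  fromℤ-neg : ∀ i → fromℤ (ℤ.- i) ≈ - fromℤ i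
  fromℤ-neg i = trans (fromℤ≈ι (ℤ.- i)) (trans (ι-neg i) (-‿cong (sym (fromℤ≈ι i))))

  fromℤ-- : ∀ i j → fromℤ (i ℤ.- j) ≈ fromℤ i - fromℤ j
  fromℤ-- i j = trans (fromℤ-+ i (ℤ.- j)) (+-congˡ (fromℤ-neg j))

  fromℤ-nonneg : ∀ {i} → 0ℤ ℤ.≤ i → 0≤ fromℤ i
  fromℤ-nonneg {+ zero}  _ = inj₂ refl
  fromℤ-nonneg {+ suc n} _ = inj₁ (pos-+-nonneg 0<1 (fromℤ-nonneg {+ n} (ℤ.+≤+ z≤n)))

  fromℤ-pos : ∀ {i} → 0ℤ ℤ.< i → 0# < fromℤ i
  fromℤ-pos {+ suc n} _ = pos-+-nonneg 0<1 (fromℤ-nonneg {+ n} (ℤ.+≤+ z≤n))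
  fromℤ-pos {+ zero} (ℤ.+<+ ())

  fromℤ-pos⁻¹ : ∀ {i} → 0# < fromℤ i → 0ℤ ℤ.< i
  fromℤ-pos⁻¹ {+ zero}   0<0 = contradiction 0<0 (irrefl refl)
  fromℤ-pos⁻¹ {+ suc n}  _   = ℤ.+<+ (s≤s z≤n)
  fromℤ-pos⁻¹ { -[1+ n ]} 0<i = contradiction 0<i
    (0<-⇒≮ (<-respʳ (sym (-‿involutive _)) (fromℤ-pos {+ suc n} (ℤ.+<+ (s≤s z≤n)))))

  -- Characteristic zero: a nonzero difference `i - j` would have a nonzero image, by its sign.
  fromℤ-injective : ∀ {i j} → fromℤ i ≈ fromℤ j → i ≡ j
  fromℤ-injective {i} {j} i≈j with ℤ.<-cmp (i ℤ.- j) 0ℤ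
  ... | tri≈ _ i-j≡0 _ = ℤ.i-j≡0⇒i≡j i j i-j≡0
  ... | tri> _ _ 0<i-j = contradiction
    (trans (fromℤ-- i j) (trans (+-congʳ i≈j) (-‿inverseʳ _))) (0<⇒≉0 (fromℤ-pos 0<i-j))
  ... | tri< i-j<0 _ _ = contradiction
    (trans (fromℤ-neg (i ℤ.- j)) (trans (-‿cong (trans (fromℤ-- i j) (trans (+-congʳ i≈j) (-‿inverseʳ _)))) -0#≈0#))
    (0<⇒≉0 (fromℤ-pos (ℤ.neg-mono-< i-j<0)))

-- Linear combinations, linear functionals and their values on reflected vectors.

module LinearFunctionals {c ℓ₁ ℓ₂ e ℓ} {K : OrderedField c ℓ₁ ℓ₂} (E : EuclideanSpace K e ℓ) where
  open OrderedField K hiding (zero)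
  open EuclideanSpace E
  open IntegerCoefficients commutativeRing using (module Solver)
  open Solver using (solve; _:=_; _:-_; _:*_)
  open FiniteSums commutativeRing
  open RingProperties ring using (+-inverseʳ-unique)
  open CommutativeSemigroupProperties (CommutativeMonoid.commutativeSemigroup +ᴹ-commutativeMonoid) using ()
    renaming (interchange to +ᴹ-interchange)

  linComb-cong : ∀ {k} {a b : Fin k → Carrier} (v : Fin k → Carrierᴹ) →
                 (∀ i → a i ≈ b i) → linComb a v ≈ᴹ linComb b v
  linComb-cong {zero}  v a≈b = ≈ᴹ-refl
  linComb-cong {suc k} v a≈b = +ᴹ-cong (*ₗ-cong (a≈b zero) ≈ᴹ-refl) (linComb-cong (v ∘ suc) (a≈b ∘ suc))

  linComb-zero : ∀ {k} {a : Fin k → Carrier} (v : Fin k → Carrierᴹ) →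
                 (∀ i → a i ≈ 0#) → linComb a v ≈ᴹ 0ᴹ
  linComb-zero {zero}  v a≈0 = ≈ᴹ-refl
  linComb-zero {suc k} v a≈0 = ≈ᴹ-trans
    (+ᴹ-cong (≈ᴹ-trans (*ₗ-cong (a≈0 zero) ≈ᴹ-refl) (*ₗ-zeroˡ _)) (linComb-zero (v ∘ suc) (a≈0 ∘ suc)))
    (+ᴹ-identityˡ 0ᴹ)

  linComb-+ : ∀ {k} (a b : Fin k → Carrier) (v : Fin k → Carrierᴹ) →
              linComb (λ i → a i + b i) v ≈ᴹ linComb a v +ᴹ linComb b v
  linComb-+ {zero}  a b v = ≈ᴹ-sym (+ᴹ-identityˡ 0ᴹ)
  linComb-+ {suc k} a b v = ≈ᴹ-trans
    (+ᴹ-cong (*ₗ-distribʳ (v zero) (a zero) (b zero)) (linComb-+ (a ∘ suc) (b ∘ suc) (v ∘ suc)))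
    (+ᴹ-interchange _ _ _ _)

  linComb-* : ∀ {k} x (a : Fin k → Carrier) (v : Fin k → Carrierᴹ) →
              linComb (λ i → x * a i) v ≈ᴹ x *ₗ linComb a v
  linComb-* {zero}  x a v = ≈ᴹ-sym (*ₗ-zeroʳ x)
  linComb-* {suc k} x a v = ≈ᴹ-trans
    (+ᴹ-cong (*ₗ-assoc x (a zero) (v zero)) (linComb-* x (a ∘ suc) (v ∘ suc)))
    (≈ᴹ-sym (*ₗ-distribˡ x _ _))

  -- Pairings, coordinates, `F` and `state c` are all instances, so general formulas are proved
  -- once.
  record IsLinear (L : Carrierᴹ → Carrier) : Set (c ⊔ ℓ₁ ⊔ e ⊔ ℓ) where
    field
      ≈-homo  : ∀ {x y} → x ≈ᴹ y → L x ≈ L y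
      +-homo  : ∀ x y → L (x +ᴹ y) ≈ L x + L y
      *-homo  : ∀ k x → L (k *ₗ x) ≈ k * L x

    0-homo : L 0ᴹ ≈ 0#
    0-homo = trans (≈-homo (≈ᴹ-sym (*ₗ-zeroˡ 0ᴹ))) (trans (*-homo 0# 0ᴹ) (zeroˡ _))

    -‿homo : ∀ x → L (-ᴹ x) ≈ - L x
    -‿homo x = +-inverseʳ-unique (L x) (L (-ᴹ x))
      (trans (sym (+-homo x (-ᴹ x))) (trans (≈-homo (-ᴹ‿inverseʳ x)) 0-homo))

    linComb-homo : ∀ {k} (a : Fin k → Carrier) v → L (linComb a v) ≈ sum (λ i → a i * L (v i))
    linComb-homo {zero}  a v = 0-homo
    linComb-homo {suc k} a v = trans (+-homo _ _) (+-cong (*-homo _ _) (linComb-homo (a ∘ suc) (v ∘ suc)))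

  open IsLinear

  -- The scalar that turns a root into its coroot.
  κ : Carrierᴹ → Carrier
  κ α = (1# + 1#) * ⟪ α , α ⟫ ⁻¹

  ⟪⟫-congˡ : ∀ {x y} z → x ≈ᴹ y → ⟪ x , z ⟫ ≈ ⟪ y , z ⟫
  ⟪⟫-congˡ z x≈y = ⟪⟫-cong x≈y ≈ᴹ-refl

  ⟪⟫-congʳ : ∀ z {x y} → x ≈ᴹ y → ⟪ z , x ⟫ ≈ ⟪ z , y ⟫
  ⟪⟫-congʳ z = ⟪⟫-cong ≈ᴹ-refl

  pairing-linearˡ : ∀ z → IsLinear (λ x → ⟪ x , z ⟫)
  pairing-linearˡ z = record
    { ≈-homo  = ⟪⟫-congˡ z
    ; +-homo  = λ x y → ⟪⟫-+ˡ x y z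
    ; *-homo  = λ k x → ⟪⟫-*ˡ k x z
    }

  pairing-linearʳ : ∀ z → IsLinear (λ x → ⟪ z , x ⟫)
  pairing-linearʳ z = record
    { ≈-homo  = ⟪⟫-congʳ z
    ; +-homo  = λ x y → trans (⟪⟫-sym _ _) (trans (⟪⟫-+ˡ x y z) (+-cong (⟪⟫-sym _ _) (⟪⟫-sym _ _)))
    ; *-homo  = λ k x → trans (⟪⟫-sym _ _) (trans (⟪⟫-*ˡ k x z) (*-congˡ (⟪⟫-sym _ _)))
    }

  ⟪⟫-^∨ : ∀ x α → ⟪ x , α ^∨ ⟫ ≈ κ α * ⟪ x , α ⟫
  ⟪⟫-^∨ x α = *-homo (pairing-linearʳ x) (κ α) α

  linear-reflect : ∀ {L} → IsLinear L → ∀ α x → L (reflect α x) ≈ L x - κ α * ⟪ x , α ⟫ * L α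
  linear-reflect linear α x = trans (+-homo linear _ _) (+-congˡ (trans (-‿homo linear _)
    (-‿cong (trans (*-homo linear _ _) (*-congʳ (⟪⟫-^∨ x α))))))

  reflect-cong : ∀ α {x y} → x ≈ᴹ y → reflect α x ≈ᴹ reflect α y
  reflect-cong α x≈y = +ᴹ-cong x≈y (-ᴹ‿cong (*ₗ-cong (⟪⟫-congˡ (α ^∨) x≈y) ≈ᴹ-refl))

  -- By `linear-reflect` both sides expand to the same expression, symmetric in `x` and `y`.
  reflect-symmetric : ∀ α x y → ⟪ reflect α x , y ⟫ ≈ ⟪ x , reflect α y ⟫
  reflect-symmetric α x y = begin
    ⟪ reflect α x , y ⟫                          ≈⟨ linear-reflect (pairing-linearˡ y) α x ⟩
    ⟪ x , y ⟫ - κ α * ⟪ x , α ⟫ * ⟪ α , y ⟫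
      ≈⟨ solve 4 (λ s k a b → s :- k :* a :* b := s :- k :* b :* a) refl _ _ _ _ ⟩
    ⟪ x , y ⟫ - κ α * ⟪ α , y ⟫ * ⟪ x , α ⟫      ≈⟨ +-congˡ (-‿cong (*-congʳ (*-congˡ (⟪⟫-sym α y)))) ⟩
    ⟪ x , y ⟫ - κ α * ⟪ y , α ⟫ * ⟪ x , α ⟫      ≈⟨ linear-reflect (pairing-linearʳ x) α y ⟨
    ⟪ x , reflect α y ⟫                          ∎
    where open SetoidReasoning setoid

-- Coordinates in the simple roots, identities between reflections, and positive roots.

module RootSystemProperties {c ℓ₁ ℓ₂ e ℓ} {K : OrderedField c ℓ₁ ℓ₂} {E : EuclideanSpace K e ℓ}
                            (Φ : RootSystem E) {n : ℕ} (B : Base Φ n) where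
  open OrderedField K hiding (zero)
  open EuclideanSpace E
  open RootSystem Φ
  open Base B
  open WeylGroup Φ B using (_∈Φ⁺)
  open LinearFunctionals E
  open IsLinear
  open OrderedFieldProperties K
  open IntegerCoefficients commutativeRing using (module Solver)
  open Solver using (solve; _:=_; _:-_; :-_; _:*_; con)
  open FiniteSums commutativeRing
  open RingProperties ring using (-0#≈0#; x∙y⁻¹≈ε⇒x≈y; -1*x≈-x)
  open GroupProperties +ᴹ-group using () renaming (x∙y⁻¹≈ε⇒x≈y to x∙y⁻¹≈ε⇒x≈yᴹ)
  private module R = SetoidReasoning setoid

  InSpan : Carrierᴹ → Set _
  InSpan x = ∃ λ a → x ≈ᴹ linComb a simple

  linComb-InSpan : ∀ {k} (b : Fin k → Carrier) {v : Fin k → Carrierᴹ} →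
                   (∀ i → InSpan (v i)) → InSpan (linComb b v)
  linComb-InSpan {zero}  b v∈ = (λ _ → 0#) , ≈ᴹ-sym (linComb-zero simple (λ _ → refl))
  linComb-InSpan {suc k} b v∈ with v∈ zero | linComb-InSpan (b ∘ suc) (v∈ ∘ suc)
  ... | a , v≈ | a′ , rest≈ = (λ i → b zero * a i + a′ i) , ≈ᴹ-sym (≈ᴹ-trans
    (linComb-+ (λ i → b zero * a i) a′ simple)
    (+ᴹ-cong (≈ᴹ-trans (linComb-* (b zero) a simple) (*ₗ-cong refl (≈ᴹ-sym v≈))) (≈ᴹ-sym rest≈)))

  -- The roots span, and each root is a combination of simple roots by `decomposition`.
  simple-spans : ∀ x → InSpan x
  simple-spans x with spanning x
  ... | b , x≈ with linComb-InSpan b (λ k → let z , root≈ , _ = decomposition (k , ≈ᴹ-refl) in (λ i → fromℤ (z i)) , root≈)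
  ...   | a , ≈a = a , ≈ᴹ-trans x≈ ≈a

  -- These are the coefficients chosen by `simple-spans`; by independence the choice does not
  -- matter, see `coord-unique`.
  coord : Fin n → Carrierᴹ → Carrier
  coord i x = proj₁ (simple-spans x) i

  linComb-coord : ∀ x → x ≈ᴹ linComb (λ i → coord i x) simple
  linComb-coord x = proj₂ (simple-spans x)

  linComb-injective : ∀ a b → linComb a simple ≈ᴹ linComb b simple → ∀ i → a i ≈ b i
  linComb-injective a b a≈b i = x∙y⁻¹≈ε⇒x≈y (a i) (b i) (trans
    (+-congˡ (sym (-1*x≈-x (b i))))
    (independent (λ i → a i + - 1# * b i) combination i))
    where
    combination : linComb (λ i → a i + - 1# * b i) simple ≈ᴹ 0ᴹ
    combination = ≈ᴹ-trans (linComb-+ a (λ i → - 1# * b i) simple) (≈ᴹ-trans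
      (+ᴹ-cong (≈ᴹ-trans a≈b (≈ᴹ-sym (*ₗ-identityˡ _))) (linComb-* (- 1#) b simple))
      (≈ᴹ-trans (≈ᴹ-sym (*ₗ-distribʳ _ 1# (- 1#)))
        (≈ᴹ-trans (*ₗ-cong (-‿inverseʳ 1#) ≈ᴹ-refl) (*ₗ-zeroˡ _))))

  coord-unique : ∀ {x} a → x ≈ᴹ linComb a simple → ∀ i → coord i x ≈ a i
  coord-unique {x} a x≈a = linComb-injective _ a (≈ᴹ-trans (≈ᴹ-sym (linComb-coord x)) x≈a)

  coord-injective : ∀ {x y} → (∀ i → coord i x ≈ coord i y) → x ≈ᴹ y
  coord-injective {x} {y} x≈y =
    ≈ᴹ-trans (linComb-coord x) (≈ᴹ-trans (linComb-cong simple x≈y) (≈ᴹ-sym (linComb-coord y)))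

  coord-linear : ∀ i → IsLinear (coord i)
  coord-linear i = record
    { ≈-homo  = λ {x} {y} x≈y → coord-unique _ (≈ᴹ-trans x≈y (linComb-coord y)) i
    ; +-homo  = λ x y → coord-unique (λ j → coord j x + coord j y)
        (≈ᴹ-trans (+ᴹ-cong (linComb-coord x) (linComb-coord y)) (≈ᴹ-sym (linComb-+ _ _ simple))) i
    ; *-homo  = λ k x → coord-unique (λ j → k * coord j x)
        (≈ᴹ-trans (*ₗ-cong refl (linComb-coord x)) (≈ᴹ-sym (linComb-* k _ simple))) i
    }

  linComb-δ : ∀ {k} (v : Fin k → Carrierᴹ) i (δ : Fin k → Carrier) →
              δ i ≈ 1# → (∀ j → j ≢ i → δ j ≈ 0#) → linComb δ v ≈ᴹ v i
  linComb-δ v zero δ δ≈1 δ≈0 = ≈ᴹ-trans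
    (+ᴹ-cong (≈ᴹ-trans (*ₗ-cong δ≈1 ≈ᴹ-refl) (*ₗ-identityˡ _)) (linComb-zero (v ∘ suc) λ j → δ≈0 (suc j) λ ()))
    (+ᴹ-identityʳ _)
  linComb-δ v (suc i) δ δ≈1 δ≈0 = ≈ᴹ-trans
    (+ᴹ-cong (≈ᴹ-trans (*ₗ-cong (δ≈0 zero λ ()) ≈ᴹ-refl) (*ₗ-zeroˡ _))
      (linComb-δ (v ∘ suc) i (δ ∘ suc) δ≈1 λ j j≢i → δ≈0 (suc j) λ { ≡.refl → j≢i ≡.refl }))
    (+ᴹ-identityˡ _)

  private
    δ : Fin n → Fin n → Carrier
    δ i j with i Fin.≟ j
    ... | yes _ = 1#
    ... | no  _ = 0#

    δ-diag : ∀ i → δ i i ≈ 1#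
    δ-diag i with i Fin.≟ i
    ... | yes _  = refl
    ... | no i≢i = contradiction ≡.refl i≢i

    δ-off : ∀ i j → j ≢ i → δ i j ≈ 0#
    δ-off i j j≢i with i Fin.≟ j
    ... | yes i≡j = contradiction (≡.sym i≡j) j≢i
    ... | no _    = refl

    coord-δ : ∀ i j → coord j (simple i) ≈ δ i j
    coord-δ i = coord-unique (δ i) (≈ᴹ-sym (linComb-δ simple i (δ i) (δ-diag i) (δ-off i)))

  coord-simple-≡ : ∀ i → coord i (simple i) ≈ 1#
  coord-simple-≡ i = trans (coord-δ i i) (δ-diag i)

  coord-simple-≢ : ∀ {i j} → j ≢ i → coord j (simple i) ≈ 0#
  coord-simple-≢ {i} {j} j≢i = trans (coord-δ i j) (δ-off i j j≢i)

  coord-0⇒≈0 : ∀ {x} → (∀ i → coord i x ≈ 0#) → x ≈ᴹ 0ᴹ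
  coord-0⇒≈0 coord≈0 = coord-injective λ i → trans (coord≈0 i) (sym (0-homo (coord-linear i)))

  -- `positive-definite` by itself yields only the double negation of `x ≈ᴹ 0ᴹ`. Equality of scalars
  -- is decidable, so the argument is run on each coordinate.
  ⟪x,x⟫≈0⇒x≈0 : ∀ {x} → ⟪ x , x ⟫ ≈ 0# → x ≈ᴹ 0ᴹ
  ⟪x,x⟫≈0⇒x≈0 {x} xx≈0 = coord-0⇒≈0 coord≈0
    where
    coord≈0 : ∀ i → coord i x ≈ 0#
    coord≈0 i with coord i x ≟ 0#
    ... | yes ≈0 = ≈0
    ... | no ≉0 = contradiction xx≈0 (0<⇒≉0 (positive-definite x λ x≈0 →
      ≉0 (trans (≈-homo (coord-linear i) x≈0) (0-homo (coord-linear i)))))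

  -- Take `z` to be the difference of `x` and `y`. Through this lemma, identities between
  -- reflections become identities between scalars.
  ⟪⟫-nondegenerate : ∀ {x y} → (∀ z → ⟪ x , z ⟫ ≈ ⟪ y , z ⟫) → x ≈ᴹ y
  ⟪⟫-nondegenerate {x} {y} x~y = x∙y⁻¹≈ε⇒x≈yᴹ x y (⟪x,x⟫≈0⇒x≈0 (trans
    (+-homo (pairing-linearˡ d) x (-ᴹ y))
    (trans (+-cong (x~y d) (-‿homo (pairing-linearˡ d) y)) (-‿inverseʳ _))))
    where
    d = x +ᴹ -ᴹ y

  ⟪α,α⟫≉0 : ∀ {α} → α ≉ᴹ 0ᴹ → ⟪ α , α ⟫ ≉ 0#
  ⟪α,α⟫≉0 α≉0 = 0<⇒≉0 (positive-definite _ α≉0)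

  κ-inverse : ∀ {α} → α ≉ᴹ 0ᴹ → κ α * ⟪ α , α ⟫ ≈ 1# + 1#
  κ-inverse {α} α≉0 = R.begin
    (1# + 1#) * ⟪ α , α ⟫ ⁻¹ * ⟪ α , α ⟫    R.≈⟨ solve 3 (λ t a b → t :* a :* b := t :* (b :* a)) refl _ _ _ ⟩
    (1# + 1#) * (⟪ α , α ⟫ * ⟪ α , α ⟫ ⁻¹)  R.≈⟨ *-congˡ (⁻¹-inverse _ (⟪α,α⟫≉0 α≉0)) ⟩
    (1# + 1#) * 1#                          R.≈⟨ *-identityʳ _ ⟩
    1# + 1#                                 R.∎

  κ-cong : ∀ {α β} → α ≉ᴹ 0ᴹ → ⟪ α , α ⟫ ≈ ⟪ β , β ⟫ → κ α ≈ κ β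
  κ-cong α≉0 αα≈ββ = *-congˡ (⁻¹-cong (⟪α,α⟫≉0 α≉0) αα≈ββ)

  linear-reflect-self : ∀ {L} → IsLinear L → ∀ {α} → α ≉ᴹ 0ᴹ → L (reflect α α) ≈ - L α
  linear-reflect-self {L} linear {α} α≉0 = R.begin
    L (reflect α α)                  R.≈⟨ linear-reflect linear α α ⟩
    L α - κ α * ⟪ α , α ⟫ * L α      R.≈⟨ +-congˡ (-‿cong (*-congʳ (κ-inverse α≉0))) ⟩
    L α - (1# + 1#) * L α            R.≈⟨ solve 1 (λ x → x :- con (+ 2) :* x := :- x) refl _ ⟩
    - L α                            R.∎

  reflect-self : ∀ {α} → α ≉ᴹ 0ᴹ → reflect α α ≈ᴹ -ᴹ α
  reflect-self {α} α≉0 = ⟪⟫-nondegenerate λ z → trans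
    (linear-reflect-self (pairing-linearˡ z) α≉0) (sym (-‿homo (pairing-linearˡ z) α))

  reflect-neg : ∀ α x → reflect α (-ᴹ x) ≈ᴹ -ᴹ reflect α x
  reflect-neg α x = ⟪⟫-nondegenerate λ z → R.begin
    ⟪ reflect α (-ᴹ x) , z ⟫  R.≈⟨ reflect-symmetric α (-ᴹ x) z ⟩
    ⟪ -ᴹ x , reflect α z ⟫    R.≈⟨ -‿homo (pairing-linearˡ _) x ⟩
    - ⟪ x , reflect α z ⟫     R.≈⟨ -‿cong (reflect-symmetric α x z) ⟨
    - ⟪ reflect α x , z ⟫     R.≈⟨ -‿homo (pairing-linearˡ z) _ ⟨
    ⟪ -ᴹ reflect α x , z ⟫    R.∎

  linear-reflect² : ∀ {L} → IsLinear L → ∀ {α} → α ≉ᴹ 0ᴹ → ∀ x → L (reflect α (reflect α x)) ≈ L x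
  linear-reflect² {L} linear {α} α≉0 x = R.begin
    L (reflect α (reflect α x))                                            R.≈⟨ linear-reflect linear α _ ⟩
    L (reflect α x) - κ α * ⟪ reflect α x , α ⟫ * L α
      R.≈⟨ +-cong (linear-reflect linear α x) (-‿cong (*-congʳ (*-congˡ reflect-pair))) ⟩
    L x - κ α * ⟪ x , α ⟫ * L α - κ α * (- ⟪ x , α ⟫) * L α
      R.≈⟨ solve 4 (λ l k a b → l :- k :* a :* b :- k :* :- a :* b := l) refl _ _ _ _ ⟩
    L x                                                                    R.∎
    where
    reflect-pair : ⟪ reflect α x , α ⟫ ≈ - ⟪ x , α ⟫
    reflect-pair = trans (reflect-symmetric α x α) (linear-reflect-self (pairing-linearʳ x) α≉0)

  reflect-involutive : ∀ {α} → α ≉ᴹ 0ᴹ → ∀ x → reflect α (reflect α x) ≈ᴹ x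
  reflect-involutive α≉0 x = ⟪⟫-nondegenerate λ z → linear-reflect² (pairing-linearˡ z) α≉0 x

  reflect-isometry : ∀ {α} → α ≉ᴹ 0ᴹ → ∀ x y → ⟪ reflect α x , reflect α y ⟫ ≈ ⟪ x , y ⟫
  reflect-isometry {α} α≉0 x y =
    trans (reflect-symmetric α x _) (⟪⟫-congʳ x (reflect-involutive α≉0 y))

  reflect-congˡ : ∀ {α β} → α ≉ᴹ 0ᴹ → α ≈ᴹ β → ∀ x → reflect α x ≈ᴹ reflect β x
  reflect-congˡ {α} {β} α≉0 α≈β x = +ᴹ-cong ≈ᴹ-refl (-ᴹ‿cong (*ₗ-cong
    (⟪⟫-congʳ x (*ₗ-cong (κ-cong α≉0 (⟪⟫-cong α≈β α≈β)) α≈β)) α≈β))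

  -- Moving the self-adjoint isometry `reflect α` across the pairings turns the formula for the root
  -- `reflect α β` into the one for `β`. This is the conjugation rule behind `exchange`.
  reflect-conjugate : ∀ {α β} → α ≉ᴹ 0ᴹ → β ≉ᴹ 0ᴹ → ∀ x →
                      reflect (reflect α β) (reflect α x) ≈ᴹ reflect α (reflect β x)
  reflect-conjugate {α} {β} α≉0 β≉0 x = ⟪⟫-nondegenerate λ z → R.begin
    ⟪ reflect sβ (reflect α x) , z ⟫                             R.≈⟨ linear-reflect (pairing-linearˡ z) sβ _ ⟩
    ⟪ reflect α x , z ⟫ - κ sβ * ⟪ reflect α x , sβ ⟫ * ⟪ sβ , z ⟫
      R.≈⟨ +-cong (reflect-symmetric α x z) (-‿cong (*-cong
          (*-cong (sym (κ-cong β≉0 (sym (reflect-isometry α≉0 β β)))) (reflect-isometry α≉0 x β))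
          (reflect-symmetric α β z))) ⟩
    ⟪ x , reflect α z ⟫ - κ β * ⟪ x , β ⟫ * ⟪ β , reflect α z ⟫  R.≈⟨ linear-reflect (pairing-linearˡ _) β x ⟨
    ⟪ reflect β x , reflect α z ⟫                                R.≈⟨ reflect-symmetric α _ z ⟨
    ⟪ reflect α (reflect β x) , z ⟫                              R.∎
    where sβ = reflect α β

  ∈Φ-resp : ∀ {α β} → α ≈ᴹ β → α ∈Φ → β ∈Φ
  ∈Φ-resp α≈β (k , α≈) = k , ≈ᴹ-trans (≈ᴹ-sym α≈β) α≈

  ∈Φ⁺-resp : ∀ {α β} → α ≈ᴹ β → α ∈Φ⁺ → β ∈Φ⁺
  ∈Φ⁺-resp α≈β (α∈Φ , z , 0≤z , α≈) = ∈Φ-resp α≈β α∈Φ , z , 0≤z , ≈ᴹ-trans (≈ᴹ-sym α≈β) α≈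

  -∈Φ : ∀ {α} → α ∈Φ → (-ᴹ α) ∈Φ
  -∈Φ α∈Φ = ∈Φ-resp (reflect-self (nonzero α∈Φ)) (closed α∈Φ α∈Φ)

  ∈Φ⇒± : ∀ {α} → α ∈Φ → α ∈Φ⁺ ⊎ (-ᴹ α) ∈Φ⁺
  ∈Φ⇒± {α} α∈Φ with decomposition α∈Φ
  ... | z , α≈ , inj₁ 0≤z = inj₁ (α∈Φ , z , 0≤z , α≈)
  ... | z , α≈ , inj₂ z≤0 = inj₂ (-∈Φ α∈Φ , (λ i → ℤ.- z i) , (λ i → ℤ.neg-mono-≤ (z≤0 i)) ,
    ≈ᴹ-trans (linComb-coord (-ᴹ α)) (linComb-cong simple λ i → trans (-‿homo (coord-linear i) α)
      (trans (-‿cong (coord-unique _ α≈ i)) (sym (fromℤ-neg (z i))))))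

  coord-nonneg : ∀ {α} → α ∈Φ⁺ → ∀ i → 0≤ coord i α
  coord-nonneg (_ , z , 0≤z , α≈) i = 0≤-resp (sym (coord-unique _ α≈ i)) (fromℤ-nonneg (0≤z i))

  coord-≈0 : ∀ {α i} → 0≤ coord i α → 0≤ coord i (-ᴹ α) → coord i α ≈ 0#
  coord-≈0 {α} {i} 0≤α 0≤-α = 0≤∧≮⇒≈0 0≤α (0≤-⇒≮ (0≤-resp (-‿homo (coord-linear i) α) 0≤-α))

  -- Otherwise every coordinate of `α` would be zero, but roots are nonzero.
  Φ⁺-antisym : ∀ {α} → α ∈Φ⁺ → ¬ (-ᴹ α) ∈Φ⁺
  Φ⁺-antisym α>0 -α>0 = nonzero (proj₁ α>0)
    (coord-0⇒≈0 λ i → coord-≈0 (coord-nonneg α>0 i) (coord-nonneg -α>0 i))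

  simple≉0 : ∀ i → simple i ≉ᴹ 0ᴹ
  simple≉0 i = nonzero (simple∈Φ i)

  -- `decomposition` leaves the sign open; the `i`-th coordinate of `simple i` is `1#`, which
  -- excludes the negative case.
  simple∈Φ⁺ : ∀ i → simple i ∈Φ⁺
  simple∈Φ⁺ i with ∈Φ⇒± (simple∈Φ i)
  ... | inj₁ pos = pos
  ... | inj₂ neg = contradiction (<-respʳ (sym (coord-simple-≡ i)) 0<1)
    (0≤-⇒≮ (0≤-resp (-‿homo (coord-linear i) _) (coord-nonneg neg i)))

  -- Reflecting in αᵢ changes only the i-th coordinate, so if the sign changes
  -- then all the other coordinates vanish, and reducedness gives β = αᵢ.
  simple-reflect-negative : ∀ {β} i → β ∈Φ⁺ → (-ᴹ reflect (simple i) β) ∈Φ⁺ → β ≈ᴹ simple i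
  simple-reflect-negative {β} i β>0 -sβ>0 = conclude
    (reduced (coord i β) (simple∈Φ i) (∈Φ-resp β≈ (proj₁ β>0)))
    where
    coord-reflect : ∀ j → j ≢ i → coord j (reflect (simple i) β) ≈ coord j β
    coord-reflect j j≢i = R.begin
      coord j (reflect (simple i) β)
        R.≈⟨ linear-reflect (coord-linear j) (simple i) β ⟩
      coord j β - κ (simple i) * ⟪ β , simple i ⟫ * coord j (simple i)
        R.≈⟨ +-congˡ (-‿cong (trans (*-congˡ (coord-simple-≢ j≢i)) (zeroʳ _))) ⟩
      coord j β - 0#                                                    R.≈⟨ +-congˡ -0#≈0# ⟩
      coord j β + 0#                                                    R.≈⟨ +-identityʳ _ ⟩
      coord j β                                                         R.∎
    coord-multiple : ∀ j → coord j β ≈ coord j (coord i β *ₗ simple i)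
    coord-multiple j with j Fin.≟ i
    ... | yes ≡.refl = sym (trans (*-homo (coord-linear i) _ _) (trans (*-congˡ (coord-simple-≡ i)) (*-identityʳ _)))
    ... | no j≢i = trans
      (trans (sym (coord-reflect j j≢i)) (coord-≈0
        (0≤-resp (sym (coord-reflect j j≢i)) (coord-nonneg β>0 j)) (coord-nonneg -sβ>0 j)))
      (sym (trans (*-homo (coord-linear j) _ _) (trans (*-congˡ (coord-simple-≢ j≢i)) (zeroʳ _))))
    β≈ : β ≈ᴹ coord i β *ₗ simple i
    β≈ = coord-injective coord-multiple
    conclude : coord i β ≈ 1# ⊎ coord i β ≈ - 1# → β ≈ᴹ simple i
    conclude (inj₁ ≈1)  = ≈ᴹ-trans β≈ (≈ᴹ-trans (*ₗ-cong ≈1 ≈ᴹ-refl) (*ₗ-identityˡ _))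
    conclude (inj₂ ≈-1) = contradiction 0<1 (0≤-⇒≮ (0≤-resp ≈-1 (coord-nonneg β>0 i)))

-- Words in simple reflections: exchange, reduced words and inversions.

module WordProperties {c ℓ₁ ℓ₂ e ℓ} {K : OrderedField c ℓ₁ ℓ₂} {E : EuclideanSpace K e ℓ}
                      (Φ : RootSystem E) {n : ℕ} (B : Base Φ n) where
  open EuclideanSpace E
  open RootSystem Φ
  open Base B
  open WeylGroup Φ B
  open LinearFunctionals E
  open RootSystemProperties Φ B
  open GroupProperties +ᴹ-group using () renaming (⁻¹-involutive to -ᴹ-involutive)

  -- The recursion acts on the argument, so a letter put in front of the word reflects the argument
  -- first. `represents-∷` relies on this unfolding.
  ⟦_⟧⁻¹ : Word → Carrierᴹ → Carrierᴹ
  ⟦ [] ⟧⁻¹     x = x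
  ⟦ i ∷ is ⟧⁻¹ x = ⟦ is ⟧⁻¹ (reflect (simple i) x)

  infix 4 _≗ᵂ_
  _≗ᵂ_ : Word → Word → Set _
  is ≗ᵂ js = ∀ x → ⟦ is ⟧ x ≈ᴹ ⟦ js ⟧ x

  s-involutive : ∀ i x → reflect (simple i) (reflect (simple i) x) ≈ᴹ x
  s-involutive i = reflect-involutive (simple≉0 i)

  ⟦⟧-cong : ∀ is {x y} → x ≈ᴹ y → ⟦ is ⟧ x ≈ᴹ ⟦ is ⟧ y
  ⟦⟧-cong []       x≈y = x≈y
  ⟦⟧-cong (i ∷ is) x≈y = reflect-cong (simple i) (⟦⟧-cong is x≈y)

  ⟦⟧⁻¹-cong : ∀ is {x y} → x ≈ᴹ y → ⟦ is ⟧⁻¹ x ≈ᴹ ⟦ is ⟧⁻¹ y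
  ⟦⟧⁻¹-cong []       x≈y = x≈y
  ⟦⟧⁻¹-cong (i ∷ is) x≈y = ⟦⟧⁻¹-cong is (reflect-cong (simple i) x≈y)

  ⟦⟧⁻¹-neg : ∀ is x → ⟦ is ⟧⁻¹ (-ᴹ x) ≈ᴹ -ᴹ ⟦ is ⟧⁻¹ x
  ⟦⟧⁻¹-neg []       x = ≈ᴹ-refl
  ⟦⟧⁻¹-neg (i ∷ is) x = ≈ᴹ-trans (⟦⟧⁻¹-cong is (reflect-neg (simple i) x)) (⟦⟧⁻¹-neg is _)

  ⟦⟧∘⟦⟧⁻¹ : ∀ is x → ⟦ is ⟧ (⟦ is ⟧⁻¹ x) ≈ᴹ x
  ⟦⟧∘⟦⟧⁻¹ []       x = ≈ᴹ-refl
  ⟦⟧∘⟦⟧⁻¹ (i ∷ is) x = ≈ᴹ-trans (reflect-cong (simple i) (⟦⟧∘⟦⟧⁻¹ is _)) (s-involutive i x)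

  ⟦⟧⁻¹∘⟦⟧ : ∀ is x → ⟦ is ⟧⁻¹ (⟦ is ⟧ x) ≈ᴹ x
  ⟦⟧⁻¹∘⟦⟧ []       x = ≈ᴹ-refl
  ⟦⟧⁻¹∘⟦⟧ (i ∷ is) x = ≈ᴹ-trans (⟦⟧⁻¹-cong is (s-involutive i _)) (⟦⟧⁻¹∘⟦⟧ is x)

  ≗ᵂ⇒⁻¹ : ∀ {is js} → is ≗ᵂ js → ∀ x → ⟦ is ⟧⁻¹ x ≈ᴹ ⟦ js ⟧⁻¹ x
  ≗ᵂ⇒⁻¹ {is} {js} is≗js x = ≈ᴹ-trans (≈ᴹ-sym (⟦⟧⁻¹∘⟦⟧ js _))
    (⟦⟧⁻¹-cong js (≈ᴹ-trans (≈ᴹ-sym (is≗js _)) (⟦⟧∘⟦⟧⁻¹ is x)))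

  ⟦⟧-∈Φ : ∀ is {β} → β ∈Φ → ⟦ is ⟧ β ∈Φ
  ⟦⟧-∈Φ []       β∈Φ = β∈Φ
  ⟦⟧-∈Φ (i ∷ is) β∈Φ = closed (simple∈Φ i) (⟦⟧-∈Φ is β∈Φ)

  ⟦⟧⁻¹-∈Φ : ∀ is {β} → β ∈Φ → ⟦ is ⟧⁻¹ β ∈Φ
  ⟦⟧⁻¹-∈Φ []       β∈Φ = β∈Φ
  ⟦⟧⁻¹-∈Φ (i ∷ is) β∈Φ = ⟦⟧⁻¹-∈Φ is (closed (simple∈Φ i) β∈Φ)

  ⟦∷⟧⁻¹-simple : ∀ i is → ⟦ i ∷ is ⟧⁻¹ (simple i) ≈ᴹ -ᴹ ⟦ is ⟧⁻¹ (simple i)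
  ⟦∷⟧⁻¹-simple i is = ≈ᴹ-trans (⟦⟧⁻¹-cong is (reflect-self (simple≉0 i))) (⟦⟧⁻¹-neg is _)

  -- Stated for all positive roots β, not just simple ones, so that the induction can
  -- pass from β to sᵢ β.
  exchange : ∀ is {β} → β ∈Φ⁺ → (-ᴹ ⟦ is ⟧⁻¹ β) ∈Φ⁺ →
             ∃ λ js → length is ≡ suc (length js) × ∀ x → ⟦ js ⟧ x ≈ᴹ reflect β (⟦ is ⟧ x)
  exchange [] β>0 -β>0 = contradiction -β>0 (Φ⁺-antisym β>0)
  exchange (i ∷ is) {β} β>0 neg with ∈Φ⇒± (closed (simple∈Φ i) (proj₁ β>0))
  -- The deleted letter lies in `is`. Conjugating by `sᵢ` turns the reflection in `sᵢ β` into the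
  -- one in `β`.
  ... | inj₁ sβ>0 with exchange is sβ>0 neg
  ...   | js , len , js≈ = i ∷ js , ≡.cong suc len , λ x → ≈ᴹ-trans
    (reflect-cong (simple i) (js≈ x)) (≈ᴹ-trans
    (≈ᴹ-sym (reflect-conjugate (simple≉0 i) (nonzero (proj₁ sβ>0)) _))
    (reflect-congˡ (nonzero (closed (simple∈Φ i) (proj₁ sβ>0))) (s-involutive i β) _))
  -- Here `β = αᵢ`, so the deleted letter is `i` itself.
  exchange (i ∷ is) {β} β>0 neg | inj₂ -sβ>0 = is , ≡.refl , λ x → ≈ᴹ-trans
    (≈ᴹ-sym (s-involutive i _))
    (reflect-congˡ (simple≉0 i) (≈ᴹ-sym (simple-reflect-negative i β>0 -sβ>0)) _)

  -- Positivity of `w⁻¹ αᵢ` is the root criterion for `ℓ(sᵢ w) > ℓ(w)`. Required at every letter, it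
  -- characterises the reduced words.
  Positive : Word → Set ℓ
  Positive []       = ⊤
  Positive (i ∷ is) = ⟦ is ⟧⁻¹ (simple i) ∈Φ⁺ × Positive is

  Minimal : Word → Set _
  Minimal is = ∀ js → is ≗ᵂ js → length is ℕ.≤ length js

  -- Any word `js` for `sᵢ w` sends `αᵢ` to a negative root under its inverse, so `exchange` removes
  -- a letter from `js` and leaves a word for `w`; then induction applies.
  positive⇒minimal : ∀ is → Positive is → Minimal is
  positive⇒minimal [] _ js _ = z≤n
  positive⇒minimal (i ∷ is) (pos , rest) js eq =
    shorten (exchange js (simple∈Φ⁺ i) (∈Φ⁺-resp ⟦is⟧⁻¹≈ pos))
    where
    ⟦is⟧⁻¹≈ : ⟦ is ⟧⁻¹ (simple i) ≈ᴹ -ᴹ ⟦ js ⟧⁻¹ (simple i)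
    ⟦is⟧⁻¹≈ = ≈ᴹ-trans (≈ᴹ-sym (-ᴹ-involutive _)) (-ᴹ‿cong
      (≈ᴹ-trans (≈ᴹ-sym (⟦∷⟧⁻¹-simple i is)) (≗ᵂ⇒⁻¹ {i ∷ is} {js} eq (simple i))))
    shorten : (∃ λ ks → length js ≡ suc (length ks) × ∀ x → ⟦ ks ⟧ x ≈ᴹ reflect (simple i) (⟦ js ⟧ x)) →
              suc (length is) ℕ.≤ length js
    shorten (ks , len , ks≈) = ≡.subst (suc (length is) ℕ.≤_) (≡.sym len)
      (s≤s (positive⇒minimal is rest ks λ x → ≈ᴹ-trans
        (≈ᴹ-sym (s-involutive i _)) (≈ᴹ-trans (reflect-cong (simple i) (eq x)) (≈ᴹ-sym (ks≈ x)))))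

  -- If `w⁻¹ αᵢ` were negative, `exchange` would produce a word for `sᵢ w` two letters shorter.
  -- Minimality passes to the tail by prepending `i` to any competitor.
  minimal⇒positive : ∀ is → Minimal is → Positive is
  minimal⇒positive [] _ = tt
  minimal⇒positive (i ∷ is) minimal = pos , minimal⇒positive is λ js is≗js →
    ℕ.s≤s⁻¹ (minimal (i ∷ js) λ x → reflect-cong (simple i) (is≗js x))
    where
    pos : ⟦ is ⟧⁻¹ (simple i) ∈Φ⁺
    pos with ∈Φ⇒± (⟦⟧⁻¹-∈Φ is (simple∈Φ i))
    ... | inj₁ pos = pos
    ... | inj₂ neg with exchange is (simple∈Φ⁺ i) neg
    ...   | js , len , js≈ = contradiction (minimal js λ x → ≈ᴹ-sym (js≈ x))
      (ℕ.<⇒≱ (ℕ.m≤n⇒m≤1+n (ℕ.≤-reflexive (≡.sym len))))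

  reduced⇒positive : ∀ is → Reduced is → Positive is
  reduced⇒positive is (_ , minimal) = minimal⇒positive is minimal

  positive⇒reduced : ∀ is → Positive is → Reduced is
  positive⇒reduced is pos = (is , (λ _ → ≈ᴹ-refl) , ≡.refl) , positive⇒minimal is pos

  -- The bound m is fuel: each exchange shortens the word.
  positive-form : ∀ m is → length is ℕ.≤ m → ∃ λ js → length js ℕ.≤ length is × is ≗ᵂ js × Positive js
  positive-form m [] _ = [] , z≤n , (λ _ → ≈ᴹ-refl) , tt
  positive-form (suc m) (i ∷ is) (s≤s is≤m) with positive-form m is is≤m
  ... | js , js≤is , is≗js , pos with ∈Φ⇒± (⟦⟧⁻¹-∈Φ js (simple∈Φ i))
  ...   | inj₁ pos-i = i ∷ js , s≤s js≤is , (λ x → reflect-cong (simple i) (is≗js x)) , pos-i , pos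
  ...   | inj₂ neg-i with exchange js (simple∈Φ⁺ i) neg-i
  ...     | ks , len , ks≈
    -- `exchange` gives no positivity for `ks`, so it is normalised afresh; it is shorter than `js`
    -- and still fits under the bound `m`.
    with positive-form m ks (ℕ.≤-trans (ℕ.≤-trans (ℕ.n≤1+n _) (ℕ.≤-trans (ℕ.≤-reflexive (≡.sym len)) js≤is)) is≤m)
  ...       | ls , ls≤ks , ks≗ls , pos-ls =
    ls , ℕ.≤-trans ls≤ks (ℕ.≤-trans (ℕ.n≤1+n _) (ℕ.≤-trans (ℕ.≤-reflexive (≡.sym len)) (ℕ.m≤n⇒m≤1+n js≤is))) ,
    (λ x → ≈ᴹ-trans (reflect-cong (simple i) (is≗js x)) (≈ᴹ-trans (≈ᴹ-sym (ks≈ x)) (ks≗ls x))) , pos-ls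

  ∈W-resp : ∀ {w w′ J} → w ≈ᵂ w′ → w ∈W^ J → w′ ∈W^ J
  ∈W-resp w≈w′ w∈ β (β>0 , -w′β>0) = w∈ β (β>0 , ∈Φ⁺-resp (-ᴹ‿cong (≈ᴹ-sym (w≈w′ β))) -w′β>0)

  -- The only positive root made negative by `sᵢ` is `αᵢ`, so the only possible new inversion is its
  -- preimage.
  inversion-∷ : ∀ i is {β} → Inversion (product (i ∷ is)) β →
                Inversion (product is) β ⊎ β ≈ᴹ ⟦ is ⟧⁻¹ (simple i)
  inversion-∷ i is {β} (β>0 , neg) with ∈Φ⇒± (⟦⟧-∈Φ is (proj₁ β>0))
  ... | inj₂ -wβ>0 = inj₁ (β>0 , -wβ>0)
  ... | inj₁ wβ>0  = inj₂ (≈ᴹ-trans (≈ᴹ-sym (⟦⟧⁻¹∘⟦⟧ is β))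
    (⟦⟧⁻¹-cong is (simple-reflect-negative i wβ>0 neg)))

  -- No inversion is gained: the only candidate, `w⁻¹ αᵢ`, is negative.
  ∷-∈W : ∀ {J} i is → (-ᴹ ⟦ is ⟧⁻¹ (simple i)) ∈Φ⁺ → product is ∈W^ J → product (i ∷ is) ∈W^ J
  ∷-∈W i is neg is∈W β inv with inversion-∷ i is inv
  ... | inj₁ inv′ = is∈W β inv′
  ... | inj₂ β≈   = contradiction neg (Φ⁺-antisym (∈Φ⁺-resp β≈ (proj₁ inv)))

  module _ {J : Subset n} (i : Fin n) (is : Word) (pos : ⟦ is ⟧⁻¹ (simple i) ∈Φ⁺) (i∷is∈W : product (i ∷ is) ∈W^ J) where

    -- An inversion `β` of `w` stays one for `sᵢ w` unless `w β = -αᵢ`, and then `w⁻¹ αᵢ = -β` would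
    -- be negative, against `pos`.
    ∷-∈W⇒∈W : product is ∈W^ J
    ∷-∈W⇒∈W β (β>0 , -wβ>0) = [ inverted , (λ neg → contradiction (-w⁻¹αᵢ>0 neg) (Φ⁺-antisym pos)) ]′
      (∈Φ⇒± (closed (simple∈Φ i) (-∈Φ (⟦⟧-∈Φ is (proj₁ β>0)))))
      where
      inverted : reflect (simple i) (-ᴹ ⟦ is ⟧ β) ∈Φ⁺ → β ∈Φ⁺ × ¬ β ∈Φ⁺[ J ]
      inverted pos′ = i∷is∈W β (β>0 , ∈Φ⁺-resp (reflect-neg (simple i) _) pos′)
      -w⁻¹αᵢ>0 : (-ᴹ reflect (simple i) (-ᴹ ⟦ is ⟧ β)) ∈Φ⁺ → (-ᴹ ⟦ is ⟧⁻¹ (simple i)) ∈Φ⁺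
      -w⁻¹αᵢ>0 neg = ∈Φ⁺-resp (≈ᴹ-trans (≈ᴹ-sym (⟦⟧⁻¹∘⟦⟧ is β)) (≈ᴹ-trans (⟦⟧⁻¹-cong is
        (≈ᴹ-trans (≈ᴹ-sym (-ᴹ-involutive _)) (-ᴹ‿cong (simple-reflect-negative i -wβ>0 neg)))) (⟦⟧⁻¹-neg is _))) β>0

    -- The root `w⁻¹ αᵢ` is an inversion of `sᵢ w`, which maps it to `-αᵢ`.
    ∷-∈W⇒∉Φ⁺[J] : ¬ ⟦ is ⟧⁻¹ (simple i) ∈Φ⁺[ J ]
    ∷-∈W⇒∉Φ⁺[J] = proj₂ (i∷is∈W _ (pos , ∈Φ⁺-resp (≈ᴹ-sym (≈ᴹ-trans (-ᴹ‿cong (≈ᴹ-trans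
      (reflect-cong (simple i) (⟦⟧∘⟦⟧⁻¹ is _)) (reflect-self (simple≉0 i)))) (-ᴹ-involutive _))) (simple∈Φ⁺ i)))

-- The functional `F` and the description of `W^J` by its signs.

module MinimalRepresentatives {c ℓ₁ ℓ₂ e ℓ} {K : OrderedField c ℓ₁ ℓ₂} {E : EuclideanSpace K e ℓ}
                      (Φ : RootSystem E) {n : ℕ} (B : Base Φ n) (I : Subset n) where
  open OrderedField K hiding (zero)
  open EuclideanSpace E
  open RootSystem Φ
  open Base B
  open WeylGroup Φ B
  open KostantGame Φ B I
  open LinearFunctionals E
  open IsLinear
  open OrderedFieldProperties K
  open FiniteSums commutativeRing
  open RootSystemProperties Φ B
  open WordProperties Φ B
  private J = ∁ I

  N : Fin n → Carrier
  N v = ⟪ simple v , simple v ⟫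

  0<N : ∀ v → 0# < N v
  0<N v = positive-definite (simple v) (simple≉0 v)

  -- 2⟨ρ , αᵥ⟩ for a vector ρ with ⟨ρ , αᵥ^∨⟩ = εᵥ.
  height : Fin n → Carrier
  height v = fromℤ (ε v) * N v

  ε-∈ : ∀ {v} → v ∈ I → ε v ≡ 1ℤ
  ε-∈ {v} v∈I with v ∈? I
  ... | yes _  = ≡.refl
  ... | no v∉I = contradiction v∈I v∉I

  ε-∉ : ∀ {v} → v ∉ I → ε v ≡ 0ℤ
  ε-∉ {v} v∉I with v ∈? I
  ... | yes v∈I = contradiction v∈I v∉I
  ... | no _    = ≡.refl

  fromℤ-1 : fromℤ 1ℤ ≈ 1#
  fromℤ-1 = +-identityʳ 1#

  height-∈ : ∀ {v} → v ∈ I → height v ≈ N v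
  height-∈ {v} v∈I = trans (*-congʳ (trans (reflexive (≡.cong fromℤ (ε-∈ v∈I))) fromℤ-1)) (*-identityˡ _)

  0≤height : ∀ v → 0≤ height v
  0≤height v with v ∈? I
  ... | yes v∈I = inj₁ (*-pos (fromℤ-pos {1ℤ} (ℤ.+<+ (s≤s z≤n))) (0<N v))
  ... | no  v∉I = inj₂ (sym (zeroˡ _))

  -- Defined in coordinates from its values on simple roots, so that `ρ` itself need not be
  -- constructed.
  F : Carrierᴹ → Carrier
  F x = sum λ i → coord i x * height i

  F-linear : IsLinear F
  F-linear = record
    { ≈-homo  = λ x≈y → sum-cong-≋ λ i → *-congʳ (≈-homo (coord-linear i) x≈y)
    ; +-homo  = λ x y → trans
        (sum-cong-≋ λ i → trans (*-congʳ (+-homo (coord-linear i) x y)) (distribʳ _ _ _))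
        (∑-distrib-+ (λ i → coord i x * height i) (λ i → coord i y * height i))
    ; *-homo  = λ k x → trans
        (sum-cong-≋ λ i → trans (*-congʳ (*-homo (coord-linear i) k x)) (*-assoc _ _ _))
        (sym (*-distribˡ-sum k (λ i → coord i x * height i)))
    }

  F-cong : ∀ {x y} → x ≈ᴹ y → F x ≈ F y
  F-cong = ≈-homo F-linear

  F-simple : ∀ v → F (simple v) ≈ height v
  F-simple v = trans
    (sum-single (λ i → coord i (simple v) * height i) v λ j j≢v → trans (*-congʳ (coord-simple-≢ j≢v)) (zeroˡ _))
    (trans (*-congʳ (coord-simple-≡ v)) (*-identityˡ _))

  F-nonneg : ∀ {β} → β ∈Φ⁺ → 0≤ F β
  F-nonneg β>0 = sum-nonneg λ i → nonneg-* (coord-nonneg β>0 i) (0≤height i)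

  F-pos⇒∈Φ⁺ : ∀ {β} → β ∈Φ → 0# < F β → β ∈Φ⁺
  F-pos⇒∈Φ⁺ {β} β∈Φ 0<Fβ with ∈Φ⇒± β∈Φ
  ... | inj₁ β>0  = β>0
  ... | inj₂ -β>0 = contradiction 0<Fβ (0≤-⇒≮ (0≤-resp (-‿homo F-linear β) (F-nonneg -β>0)))

  -- On the span of `J` every term of `F β` vanishes: the coordinate does for `i` in `I`, the height
  -- does for the other `i`.
  F-pos⇒∉Φ⁺[J] : ∀ {β} → 0# < F β → ¬ β ∈Φ⁺[ J ]
  F-pos⇒∉Φ⁺[J] {β} 0<Fβ (_ , a , a≈0 , β≈) = 0<⇒≉0 0<Fβ (sum-zero term≈0)
    where
    term≈0 : ∀ i → coord i β * height i ≈ 0#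
    term≈0 i with i ∈? I
    ... | yes i∈I = trans (*-congʳ (trans (coord-unique a β≈ i) (a≈0 i (x∈p⇒x∉∁p i∈I)))) (zeroˡ _)
    ... | no i∉I  = trans (*-congˡ (zeroˡ _)) (zeroʳ _)

  -- `F β` is a sum of nonnegative terms with positive heights on `I`. If it were zero, all
  -- coordinates over `I` would vanish and `β` would lie in the span of `J`.
  ∉Φ⁺[J]⇒F-pos : ∀ {β} → β ∈Φ⁺ → ¬ β ∈Φ⁺[ J ] → 0# < F β
  ∉Φ⁺[J]⇒F-pos {β} β>0 β∉ with F-nonneg β>0
  ... | inj₁ 0<Fβ = 0<Fβ
  ... | inj₂ 0≈Fβ = contradiction (β>0 , (λ i → coord i β) , coord≈0 , linComb-coord β) β∉
    where
    coord≈0 : ∀ j → j ∉ J → coord j β ≈ 0#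
    coord≈0 j j∉J = 0≤∧≮⇒≈0 (coord-nonneg β>0 j) λ 0<coord → 0<⇒≉0
      (sum-pos (λ i → nonneg-* (coord-nonneg β>0 i) (0≤height i)) j
        (*-pos 0<coord (<-respʳ (sym (height-∈ (x∉∁p⇒x∈p j∉J))) (0<N j))))
      (sym 0≈Fβ)

  -- One inequality combines two demands on `w⁻¹ αᵢ`: it is positive and lies outside `Φ_J`.
  -- Admissible words are thus the reduced words of elements of `W^J`.
  Admissible : Word → Set ℓ₂
  Admissible []       = ⊤
  Admissible (i ∷ is) = 0# < F (⟦ is ⟧⁻¹ (simple i)) × Admissible is

  admissible⇒positive : ∀ is → Admissible is → Positive is
  admissible⇒positive []       _            = tt
  admissible⇒positive (i ∷ is) (0<F , rest) =
    F-pos⇒∈Φ⁺ (⟦⟧⁻¹-∈Φ is (simple∈Φ i)) 0<F , admissible⇒positive is rest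

  admissible⇒∈W : ∀ is → Admissible is → product is ∈W^ J
  admissible⇒∈W [] _ β (β>0 , -β>0) = contradiction -β>0 (Φ⁺-antisym β>0)
  admissible⇒∈W (i ∷ is) (0<F , rest) β inv = [ admissible⇒∈W is rest β , new ]′ (inversion-∷ i is inv)
    where
    new : β ≈ᴹ ⟦ is ⟧⁻¹ (simple i) → β ∈Φ⁺ × ¬ β ∈Φ⁺[ J ]
    new β≈ = proj₁ inv , F-pos⇒∉Φ⁺[J] (<-respʳ (F-cong (≈ᴹ-sym β≈)) 0<F)

  positive∧∈W⇒admissible : ∀ is → Positive is → product is ∈W^ J → Admissible is
  positive∧∈W⇒admissible []       _            _    = tt
  positive∧∈W⇒admissible (i ∷ is) (pos , rest) is∈W =
    ∉Φ⁺[J]⇒F-pos pos (∷-∈W⇒∉Φ⁺[J] i is pos is∈W) ,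
    positive∧∈W⇒admissible is rest (∷-∈W⇒∈W i is pos is∈W)

  -- A positive word for the same element suffices. Surjectivity and the induction in
  -- `admissible-unique` both rest on this.
  admissible-form : ∀ is → product is ∈W^ J → ∃ λ js → is ≗ᵂ js × Admissible js
  admissible-form is is∈W with positive-form (length is) is ℕ.≤-refl
  ... | js , _ , is≗js , pos = js , is≗js ,
    positive∧∈W⇒admissible js pos (∈W-resp {product is} {product js} is≗js is∈W)

  -- w ∈ W^J is determined by wρ.
  admissible-unique : ∀ is js → Admissible is → Admissible js →
                      (∀ x → F (⟦ is ⟧⁻¹ x) ≈ F (⟦ js ⟧⁻¹ x)) → is ≗ᵂ js
  admissible-unique [] [] _ _ _ x = ≈ᴹ-refl
  -- At `simple j` the hypothesis equates the nonnegative `height j` with the negative of the value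
  -- that `0<F` makes positive.
  admissible-unique [] (j ∷ js) _ (0<F , _) F≈ = contradiction 0<F (0≤-⇒≮
    (0≤-resp (trans (trans (sym (F-simple j)) (F≈ (simple j)))
      (trans (F-cong (⟦∷⟧⁻¹-simple j js)) (-‿homo F-linear _))) (0≤height j)))
  admissible-unique (i ∷ is) js (0<F , adm) adm-js F≈ = λ x → ≈ᴹ-trans
    (reflect-cong (simple i) (≈ᴹ-trans
      (admissible-unique is ks adm (proj₂ (proj₂ form)) F≈ks x) (≈ᴹ-sym (i∷js≗ks x))))
    (s-involutive i _)
    where
    F≈- : F (⟦ is ⟧⁻¹ (simple i)) ≈ F (-ᴹ ⟦ js ⟧⁻¹ (simple i))
    F≈- = trans (F-cong (⟦⟧⁻¹-cong is (≈ᴹ-sym (s-involutive i (simple i))))) (trans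
      (F≈ (reflect (simple i) (simple i))) (F-cong (⟦∷⟧⁻¹-simple i js)))
    -- By `F≈-` the root `⟦ js ⟧⁻¹ (simple i)` is negative, so `i ∷ js` still represents an element
    -- of `W^J`. As a word it is not admissible, hence the passage to `ks`.
    form : ∃ λ ks → i ∷ js ≗ᵂ ks × Admissible ks
    form = admissible-form (i ∷ js) (∷-∈W i js
      (F-pos⇒∈Φ⁺ (-∈Φ (⟦⟧⁻¹-∈Φ js (simple∈Φ i))) (<-respʳ F≈- 0<F)) (admissible⇒∈W js adm-js))
    ks = proj₁ form
    i∷js≗ks : i ∷ js ≗ᵂ ks
    i∷js≗ks = proj₁ (proj₂ form)
    F≈ks : ∀ x → F (⟦ is ⟧⁻¹ x) ≈ F (⟦ ks ⟧⁻¹ x)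
    F≈ks x = trans (F-cong (⟦⟧⁻¹-cong is (≈ᴹ-sym (s-involutive i x)))) (trans
      (F≈ (reflect (simple i) x)) (F-cong (≗ᵂ⇒⁻¹ {i ∷ js} {ks} i∷js≗ks x)))

-- Configurations as functionals, firing as reflection, and runs as admissible words.

module Runs {c ℓ₁ ℓ₂ e ℓ} {K : OrderedField c ℓ₁ ℓ₂} {E : EuclideanSpace K e ℓ}
                (Φ : RootSystem E) {n : ℕ} (B : Base Φ n) (I : Subset n) where
  open OrderedField K hiding (zero)
  open EuclideanSpace E
  open RootSystem Φ
  open Base B
  open WeylGroup Φ B
  open KostantGame Φ B I
  open LinearFunctionals E
  open IsLinear
  open OrderedFieldProperties K
  open IntegerCoefficients commutativeRing using (module Solver)
  open Solver using (solve; _:=_; _:+_; _:-_; :-_; _:*_; con)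
  open FiniteSums commutativeRing
  open RootSystemProperties Φ B
  open WordProperties Φ B
  open MinimalRepresentatives Φ B I
  open RingProperties ring using (-‿distribˡ-*; +-cancelˡ; -‿injective)
  private module R = SetoidReasoning setoid

  entry : Config → Fin n → Carrier
  entry c u = fromℤ (+ lookup c u)

  γ : Config → Carrierᴹ
  γ c = linComb (entry c) simple

  -- 2⟨ρ - γ c , x⟩
  state : Config → Carrierᴹ → Carrier
  state c x = F x - (1# + 1#) * ⟪ γ c , x ⟫

  ⟪γ⟫ : ∀ c x → ⟪ γ c , x ⟫ ≈ sum (λ u → entry c u * ⟪ simple u , x ⟫)
  ⟪γ⟫ c x = linComb-homo (pairing-linearˡ x) (entry c) simple

  state-linear : ∀ c → IsLinear (state c)
  state-linear c = record
    { ≈-homo  = λ x≈y → +-cong (F-cong x≈y) (-‿cong (*-congˡ (⟪⟫-congʳ (γ c) x≈y)))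
    ; +-homo  = λ x y → trans
        (+-cong (+-homo F-linear x y) (-‿cong (*-congˡ (+-homo (pairing-linearʳ (γ c)) x y))))
        (solve 4 (λ f g a b → f :+ g :- con (+ 2) :* (a :+ b) := f :- con (+ 2) :* a :+ (g :- con (+ 2) :* b)) refl _ _ _ _)
    ; *-homo  = λ k x → trans
        (+-cong (*-homo F-linear k x) (-‿cong (*-congˡ (*-homo (pairing-linearʳ (γ c)) k x))))
        (solve 3 (λ k f a → k :* f :- con (+ 2) :* (k :* a) := k :* (f :- con (+ 2) :* a)) refl _ _ _)
    }

  -- Omitted indices contribute zero. The enumeration `h` is arbitrary so that the induction can
  -- pass to `h ∘ suc`; for `allFin n` it is the identity.
  fromℤ-sum-filter : ∀ {p} {P : Fin n → Set p} (P? : ∀ u → Dec (P u)) (f : Fin n → ℤ) (g : Fin n → Carrier) →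
                     (∀ u → P u → fromℤ (f u) ≈ g u) → (∀ u → ¬ P u → g u ≈ 0#) →
                     ∀ {k} (h : Fin k → Fin n) →
                     fromℤ (foldr ℤ._+_ 0ℤ (map f (filter P? (tabulate h)))) ≈ sum (g ∘ h)
  fromℤ-sum-filter P? f g f≈g g≈0 {zero}  h = refl
  fromℤ-sum-filter P? f g f≈g g≈0 {suc k} h with P? (h zero) | fromℤ-sum-filter P? f g f≈g g≈0 (h ∘ suc)
  ... | yes p | rest = trans (fromℤ-+ (f (h zero)) _) (+-cong (f≈g _ p) rest)
  ... | no ¬p | rest = trans rest (trans (sym (+-identityˡ _)) (+-congʳ (sym (g≈0 _ ¬p))))

  fromℤ-multiplicity : ∀ v u → fromℤ (multiplicity v u) ≈ - κ (simple v) * ⟪ simple u , simple v ⟫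
  fromℤ-multiplicity v u with integral (simple∈Φ v) (simple∈Φ u)
  ... | z , z≈ = trans (fromℤ-neg z) (trans (-‿cong (trans (sym z≈) (⟪⟫-^∨ (simple u) (simple v)))) (-‿distribˡ-* _ _))

  module _ (c : Config) (v : Fin n) where

    private
      t : Fin n → Carrier
      t u = - κ (simple v) * (entry c u * ⟪ simple u , simple v ⟫)

      -- Summing `t` over all vertices includes the diagonal term `-2 cᵥ`, which is absent from the
      -- game's sum over neighbours; it is deleted here.
      t′ : Fin n → Carrier
      t′ u with v Fin.≟ u
      ... | yes _ = 0#
      ... | no _  = t u

      t≈t′ : ∀ u → u ≢ v → t u ≈ t′ u
      t≈t′ u u≢v with v Fin.≟ u
      ... | yes v≡u = contradiction (≡.sym v≡u) u≢v
      ... | no _    = refl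

      t′v≈0 : t′ v ≈ 0#
      t′v≈0 with v Fin.≟ v
      ... | yes _  = refl
      ... | no v≢v = contradiction ≡.refl v≢v

      f : Fin n → ℤ
      f u = multiplicity v u ℤ.* + lookup c u

      f≈t : ∀ u → fromℤ (f u) ≈ t u
      f≈t u = trans (fromℤ-* (multiplicity v u) (+ lookup c u)) (trans (*-congʳ (fromℤ-multiplicity v u))
        (solve 3 (λ k a b → k :* b :* a := k :* (a :* b)) refl _ _ _))

      neighbour⇒f≈t′ : ∀ u → Neighbour v u → fromℤ (f u) ≈ t′ u
      neighbour⇒f≈t′ u (v≢u , _) = trans (f≈t u) (t≈t′ u (v≢u ∘ ≡.sym))

      ¬neighbour⇒t′≈0 : ∀ u → ¬ Neighbour v u → t′ u ≈ 0#
      ¬neighbour⇒t′≈0 u ¬nb with v Fin.≟ u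
      ... | yes _  = refl
      ... | no v≢u with ⟪ simple v , simple u ⟫ ≟ 0#
      ...   | no ≉0  = contradiction (v≢u , ≉0) ¬nb
      ...   | yes ≈0 = trans (*-congˡ (trans (*-congˡ (trans (⟪⟫-sym _ _) ≈0)) (zeroʳ _))) (zeroʳ _)

      sum-t : sum t ≈ - κ (simple v) * ⟪ γ c , simple v ⟫
      sum-t = trans (sym (*-distribˡ-sum (- κ (simple v)) (λ u → entry c u * ⟪ simple u , simple v ⟫)))
        (*-congˡ (sym (⟪γ⟫ c (simple v))))

      tv : t v ≈ - ((1# + 1#) * entry c v)
      tv = R.begin
        - κ (simple v) * (entry c v * N v)
          R.≈⟨ solve 3 (λ k a b → :- k :* (a :* b) := :- (k :* b :* a)) refl _ _ _ ⟩
        - (κ (simple v) * N v * entry c v)    R.≈⟨ -‿cong (*-congʳ (κ-inverse (simple≉0 v))) ⟩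
        - ((1# + 1#) * entry c v)             R.∎

      sum-t′ : sum t′ ≈ sum t + (1# + 1#) * entry c v
      sum-t′ = R.begin
        sum t′                                            R.≈⟨ solve 2 (λ a b → a := a :- b :+ b) refl _ _ ⟩
        sum t′ - (1# + 1#) * entry c v + (1# + 1#) * entry c v R.≈⟨ +-congʳ (+-congˡ tv) ⟨
        sum t′ + t v + (1# + 1#) * entry c v              R.≈⟨ +-congʳ (sum-update t t′ v t≈t′) ⟨
        sum t + t′ v + (1# + 1#) * entry c v              R.≈⟨ +-congʳ (trans (+-congˡ t′v≈0) (+-identityʳ _)) ⟩
        sum t + (1# + 1#) * entry c v                     R.∎

    -- Summed over all vertices, the terms give `-⟨γ c , αᵥ^∨⟩`. Removing the diagonal term `-2 cᵥ`
    -- accounts for the summand `2 cᵥ`.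
    fromℤ-surround : fromℤ (surround c v) ≈
      - κ (simple v) * ⟪ γ c , simple v ⟫ + (1# + 1#) * entry c v + fromℤ (ε v)
    fromℤ-surround = trans (fromℤ-+ (foldr ℤ._+_ 0ℤ (map f (neighbours v))) (ε v)) (+-congʳ
      (trans (fromℤ-sum-filter (neighbour? v) f t′ neighbour⇒f≈t′ ¬neighbour⇒t′≈0 (λ u → u))
        (trans sum-t′ (+-congʳ sum-t))))

    -- The amount that firing adds to `cᵥ`. It equals `⟨ρ - γ c , αᵥ^∨⟩`.
    excess : ℤ
    excess = surround c v ℤ.- + 2 ℤ.* + lookup c v

    fromℤ-excess : fromℤ excess ≈ - κ (simple v) * ⟪ γ c , simple v ⟫ + fromℤ (ε v)
    fromℤ-excess = R.begin
      fromℤ excess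
        R.≈⟨ fromℤ-- (surround c v) (+ 2 ℤ.* + lookup c v) ⟩
      fromℤ (surround c v) - fromℤ (+ 2 ℤ.* + lookup c v)
        R.≈⟨ +-cong fromℤ-surround (-‿cong (trans (fromℤ-* (+ 2) (+ lookup c v)) (*-congʳ (fromℤ≈ι (+ 2))))) ⟩
      - κ (simple v) * ⟪ γ c , simple v ⟫ + (1# + 1#) * entry c v + fromℤ (ε v) - (1# + 1#) * entry c v
        R.≈⟨ solve 3 (λ a b d → a :+ b :+ d :- b := a :+ d) refl _ _ _ ⟩
      - κ (simple v) * ⟪ γ c , simple v ⟫ + fromℤ (ε v)         R.∎

    state-simple : state c (simple v) ≈ N v * fromℤ excess
    state-simple = R.begin
      F (simple v) - (1# + 1#) * ⟪ γ c , simple v ⟫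
        R.≈⟨ +-cong (F-simple v) (-‿cong (*-congʳ (sym (κ-inverse (simple≉0 v))))) ⟩
      fromℤ (ε v) * N v - κ (simple v) * N v * ⟪ γ c , simple v ⟫
        R.≈⟨ solve 4 (λ e n k g → e :* n :- k :* n :* g := n :* (:- k :* g :+ e)) refl _ _ _ _ ⟩
      N v * (- κ (simple v) * ⟪ γ c , simple v ⟫ + fromℤ (ε v))        R.≈⟨ *-congˡ fromℤ-excess ⟨
      N v * fromℤ excess                                               R.∎

    state-reflect : ∀ x → state c (reflect (simple v) x) ≈ state c x - (1# + 1#) * (fromℤ excess * ⟪ simple v , x ⟫)
    state-reflect x = R.begin
      state c (reflect (simple v) x)
        R.≈⟨ linear-reflect (state-linear c) (simple v) x ⟩
      state c x - κ (simple v) * ⟪ x , simple v ⟫ * state c (simple v)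
        R.≈⟨ +-congˡ (-‿cong (*-cong (*-congˡ (⟪⟫-sym _ _)) state-simple)) ⟩
      state c x - κ (simple v) * ⟪ simple v , x ⟫ * (N v * fromℤ excess)
        R.≈⟨ solve 5 (λ s k a b d → s :- k :* a :* (b :* d) := s :- k :* b :* (d :* a)) refl _ _ _ _ _ ⟩
      state c x - κ (simple v) * N v * (fromℤ excess * ⟪ simple v , x ⟫)
        R.≈⟨ +-congˡ (-‿cong (*-congʳ (κ-inverse (simple≉0 v)))) ⟩
      state c x - (1# + 1#) * (fromℤ excess * ⟪ simple v , x ⟫)                    R.∎

    sad⇒0<excess : Sad c v → 0ℤ ℤ.< excess
    sad⇒0<excess sad = ≡.subst (ℤ._< excess) (ℤ.+-inverseʳ (+ 2 ℤ.* + lookup c v))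
      (ℤ.+-monoˡ-< (ℤ.- (+ 2 ℤ.* + lookup c v)) sad)

    0<excess⇒sad : 0ℤ ℤ.< excess → Sad c v
    0<excess⇒sad 0<excess = ≡.subst₂ ℤ._<_ (ℤ.+-identityˡ _)
      (solve′ 2 (λ s d → s ⊝ d ⊕ d ⊜ s) ≡.refl (surround c v) (+ 2 ℤ.* + lookup c v))
      (ℤ.+-monoˡ-< (+ 2 ℤ.* + lookup c v) 0<excess)
      where open ℤSolver.+-*-Solver using () renaming (solve to solve′; _:+_ to _⊕_; _:-_ to _⊝_; _:=_ to _⊜_)

    -- Sadness is positivity of `excess`, and `state c (simple v)` is its multiple by the positive
    -- `N v`.
    sad⇔state-pos : Sad c v ⇔ 0# < state c (simple v)
    sad⇔state-pos = mk⇔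
      (λ sad → <-respʳ (sym state-simple) (*-pos (0<N v) (fromℤ-pos {excess} (sad⇒0<excess sad))))
      (λ 0<state → 0<excess⇒sad (fromℤ-pos⁻¹ {excess} (pos-*-cancelˡ (0<N v) (<-respʳ state-simple 0<state))))

    surround-excess : surround c v ℤ.- + lookup c v ≡ excess ℤ.+ + lookup c v
    surround-excess = solve′ 2 (λ s d → s ⊝ d ⊜ s ⊝ (κ′ (+ 2) ⊛ d) ⊕ d) ≡.refl (surround c v) (+ lookup c v)
      where open ℤSolver.+-*-Solver using ()
               renaming (solve to solve′; _:+_ to _⊕_; _:-_ to _⊝_; _:*_ to _⊛_; con to κ′; _:=_ to _⊜_)

    sad⇒fires : Sad c v → ∃ λ c′ → Fires c v c′
    -- The absolute value changes nothing: `new` is `excess` plus the old entry, both nonnegative at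
    -- a sad vertex.
    sad⇒fires sad = c [ v ]≔ ℤ.∣ new ∣ , record
      { sad    = sad
      ; fired  = ≡.trans (≡.cong +_ (lookup∘update v c ℤ.∣ new ∣)) (ℤ.0≤i⇒+∣i∣≡i 0≤new)
      ; others = λ u u≢v → lookup∘update′ u≢v c ℤ.∣ new ∣
      }
      where
      new = surround c v ℤ.- + lookup c v
      0≤new : 0ℤ ℤ.≤ new
      0≤new = ≡.subst (0ℤ ℤ.≤_) (≡.sym surround-excess)
        (ℤ.+-mono-≤ (ℤ.<⇒≤ (sad⇒0<excess sad)) (ℤ.+≤+ z≤n))

  -- Firing adds `excess` times `αᵥ` to `γ c`, which is the change that `state-reflect` computes for
  -- the reflection.
  state-fires : ∀ {c v c′} → Fires c v c′ → ∀ x → state c′ x ≈ state c (reflect (simple v) x)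
  state-fires {c} {v} {c′} fires x = R.begin
    F x - (1# + 1#) * ⟪ γ c′ , x ⟫
      R.≈⟨ +-congˡ (-‿cong (*-congˡ pairing)) ⟩
    F x - (1# + 1#) * (⟪ γ c , x ⟫ + fromℤ (excess c v) * ⟪ simple v , x ⟫)
      R.≈⟨ solve 3 (λ f g d → f :- con (+ 2) :* (g :+ d) := f :- con (+ 2) :* g :- con (+ 2) :* d) refl _ _ _ ⟩
    state c x - (1# + 1#) * (fromℤ (excess c v) * ⟪ simple v , x ⟫)              R.≈⟨ state-reflect c v x ⟨
    state c (reflect (simple v) x)                                               R.∎
    where
    open Fires fires
    term : Config → Fin n → Carrier
    term d u = entry d u * ⟪ simple u , x ⟫
    entry-fired : entry c′ v ≈ fromℤ (excess c v) + entry c v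
    entry-fired = trans (reflexive (≡.cong fromℤ (≡.trans fired (surround-excess c v)))) (fromℤ-+ (excess c v) (+ lookup c v))
    pairing : ⟪ γ c′ , x ⟫ ≈ ⟪ γ c , x ⟫ + fromℤ (excess c v) * ⟪ simple v , x ⟫
    pairing = R.begin
      ⟪ γ c′ , x ⟫                                 R.≈⟨ ⟪γ⟫ c′ x ⟩
      sum (term c′)                                R.≈⟨ solve 2 (λ a b → a := a :+ b :- b) refl _ _ ⟩
      sum (term c′) + term c v - term c v
        R.≈⟨ +-congʳ (sum-update (term c′) (term c) v λ u u≢v → *-congʳ (reflexive (≡.cong (fromℤ ∘ +_) (others u u≢v)))) ⟩
      sum (term c) + term c′ v - term c v          R.≈⟨ +-congʳ (+-cong (sym (⟪γ⟫ c x)) (*-congʳ entry-fired)) ⟩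
      ⟪ γ c , x ⟫ + (fromℤ (excess c v) + entry c v) * ⟪ simple v , x ⟫ - term c v
        R.≈⟨ solve 4 (λ g d a s → g :+ (d :+ a) :* s :- a :* s := g :+ d :* s) refl _ _ _ _ ⟩
      ⟪ γ c , x ⟫ + fromℤ (excess c v) * ⟪ simple v , x ⟫  R.∎

  -- Cancelling `F` and the factor 2 recovers `γ c` by nondegeneracy, and independence of the simple
  -- roots recovers the entries.
  state-injective : ∀ {c c′} → (∀ x → state c x ≈ state c′ x) → c ≡ c′
  state-injective {c} {c′} state≈ = ≡.trans (≡.sym (tabulate∘lookup c))
    (≡.trans (tabulate-cong lookup≡) (tabulate∘lookup c′))
    where
    halve : ∀ {x y} → (1# + 1#) * x ≈ (1# + 1#) * y → x ≈ y
    halve {x} {y} 2x≈2y = trans (sym (half x)) (trans (*-congˡ 2x≈2y) (half y))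
      where
      half : ∀ z → (1# + 1#) ⁻¹ * ((1# + 1#) * z) ≈ z
      half z = trans (solve 3 (λ a b d → b :* (a :* d) := a :* b :* d) refl _ _ _)
        (trans (*-congʳ (⁻¹-inverse (1# + 1#) (0<⇒≉0 (pos-+-nonneg 0<1 (inj₁ 0<1))))) (*-identityˡ z))
    γ≈ : γ c ≈ᴹ γ c′
    γ≈ = ⟪⟫-nondegenerate λ x → halve (-‿injective (+-cancelˡ _ _ _ (state≈ x)))
    lookup≡ : ∀ i → lookup c i ≡ lookup c′ i
    lookup≡ i = ℤ.+-injective (fromℤ-injective (linComb-injective (entry c) (entry c′) γ≈ i))

  -- Encodes `ρ - γ c = w ρ` for the product `w` of `is`, using `⟨w ρ , x⟩ = ⟨ρ , w⁻¹ x⟩`.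
  Represents : Word → Config → Set _
  Represents is c = ∀ x → state c x ≈ F (⟦ is ⟧⁻¹ x)

  represents-𝟎 : Represents [] 𝟎
  represents-𝟎 x = R.begin
    F x - (1# + 1#) * ⟪ γ 𝟎 , x ⟫  R.≈⟨ +-congˡ (-‿cong (*-congˡ (trans (⟪γ⟫ 𝟎 x) (sum-zero term≈0)))) ⟩
    F x - (1# + 1#) * 0#           R.≈⟨ solve 1 (λ f → f :- con (+ 2) :* con 0ℤ := f) refl _ ⟩
    F x                            R.∎
    where
    term≈0 : ∀ u → entry 𝟎 u * ⟪ simple u , x ⟫ ≈ 0#
    term≈0 u = trans (*-congʳ (reflexive (≡.cong (fromℤ ∘ +_) (lookup-replicate u 0)))) (zeroˡ _)

  represents-∷ : ∀ {is c v c′} → Represents is c → Fires c v c′ → Represents (v ∷ is) c′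
  represents-∷ {v = v} rep fires x = trans (state-fires fires x) (rep (reflect (simple v) x))

  -- `ʳ++` pushes fired vertices onto the front of the word one by one; from the empty word this
  -- gives `reverse ks`.
  run-represents : ∀ {is c ks d} → Represents is c → Run c ks d → Represents (ks ʳ++ is) d
  run-represents rep []             = rep
  run-represents {is} {c} rep (_∷_ {k} fires run) =
    run-represents {k ∷ is} (represents-∷ {is} {c} rep fires) run

  module _ {c : Config} {is : Word} {v : Fin n} (rep : Represents is c) where

    sad⇒admissible : Sad c v → 0# < F (⟦ is ⟧⁻¹ (simple v))
    sad⇒admissible sad = <-respʳ (rep (simple v)) (Equivalence.to (sad⇔state-pos c v) sad)

    admissible⇒sad : 0# < F (⟦ is ⟧⁻¹ (simple v)) → Sad c v
    admissible⇒sad 0<F = Equivalence.from (sad⇔state-pos c v) (<-respʳ (sym (rep (simple v))) 0<F)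

  run⇒admissible : ∀ {is c ks d} → Represents is c → Admissible is → Run c ks d → Admissible (ks ʳ++ is)
  run⇒admissible rep adm [] = adm
  run⇒admissible {is} {c} rep adm (_∷_ {k} fires run) = run⇒admissible {k ∷ is}
    (represents-∷ {is} {c} rep fires)
    (sad⇒admissible {c} {is} {k} rep (Fires.sad fires) , adm) run

  admissible-suffix : ∀ ks {is} → Admissible (ks ʳ++ is) → Admissible is
  admissible-suffix []       adm = adm
  admissible-suffix (k ∷ ks) adm = proj₂ (admissible-suffix ks adm)

  -- Admissibility of the whole word restricts to `k ∷ is`, where its head condition says that the
  -- next vertex `k` is sad.
  admissible⇒run : ∀ {is c} ks → Represents is c → Admissible (ks ʳ++ is) → ∃ λ d → Run c ks d
  admissible⇒run {c = c} [] rep adm = c , []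
  admissible⇒run {is} {c} (k ∷ ks) rep adm =
    let sad = admissible⇒sad {c} {is} {k} rep (proj₁ (admissible-suffix ks {k ∷ is} adm))
        c′ , fires = sad⇒fires c k sad
        d , run = admissible⇒run {k ∷ is} ks (represents-∷ {is} {c} rep fires) adm
    in d , fires ∷ run

-- Valid firing sequences as reduced words, and the bijection onto `W^J`.

theorem3p8 :
    ∀ {c ℓ₁ ℓ₂ e ℓ} {K : OrderedField c ℓ₁ ℓ₂} {E : EuclideanSpace K e ℓ}
      (Φ : RootSystem E) {n : ℕ} (B : Base Φ n) (I : Subset n) →
    let open WeylGroup Φ B
        open KostantGame Φ B I
        J = ∁ I
    in
    (∀ (ks : List (Fin n)) →
      Valid ks ⇔ (Reduced (reverse ks) × product (reverse ks) ∈W^ J))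
    ×
    (Σ (Bijection reachableSetoid (W^-setoid J)) λ φ →
      ∀ ks d (run : Run 𝟎 ks d) →
      proj₁ (Bijection.to φ (d , ks , run)) ≈ᵂ product (reverse ks))
theorem3p8 {K = K} {E = E} Φ {n} B I = (λ ks → mk⇔ (valid⇒ ks) (valid⇐ ks)) , bijection , λ _ _ _ _ → ≈ᴹ-refl
  where
  open OrderedField K using (trans; sym; reflexive)
  open EuclideanSpace E
  open WeylGroup Φ B
  open KostantGame Φ B I
  open WordProperties Φ B
  open MinimalRepresentatives Φ B I
  open Runs Φ B I
  J = ∁ I

  admissible : ∀ {ks d} → Run 𝟎 ks d → Admissible (reverse ks)
  admissible = run⇒admissible {[]} represents-𝟎 tt

  represents : ∀ {ks d} → Run 𝟎 ks d → Represents (reverse ks) d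
  represents = run-represents {[]} represents-𝟎

  valid⇒ : ∀ ks → Valid ks → Reduced (reverse ks) × product (reverse ks) ∈W^ J
  valid⇒ ks (d , run) = positive⇒reduced _ (admissible⇒positive _ (admissible run)) , admissible⇒∈W _ (admissible run)

  valid⇐ : ∀ ks → Reduced (reverse ks) × product (reverse ks) ∈W^ J → Valid ks
  valid⇐ ks (red , ∈W) = admissible⇒run {[]} ks represents-𝟎
    (positive∧∈W⇒admissible (reverse ks) (reduced⇒positive (reverse ks) red) ∈W)

  to : Σ Config Reachable → Σ Weyl (_∈W^ J)
  to (d , ks , run) = product (reverse ks) , admissible⇒∈W (reverse ks) (admissible run)

  -- `to` reads off a word from one chosen run. The configuration fixes `state`, hence `w ρ`, hence
  -- `w`, so the choice of run is immaterial.
  to-cong : ∀ {x y} → proj₁ x ≡ proj₁ y → proj₁ (to x) ≈ᵂ proj₁ (to y)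
  to-cong {d , ks , run} {d′ , ks′ , run′} d≡d′ = admissible-unique (reverse ks) (reverse ks′)
    (admissible run) (admissible run′) λ x →
      trans (sym (represents run x)) (trans (reflexive (≡.cong (λ c → state c x) d≡d′)) (represents run′ x))

  to-injective : ∀ {x y} → proj₁ (to x) ≈ᵂ proj₁ (to y) → proj₁ x ≡ proj₁ y
  to-injective {d , ks , run} {d′ , ks′ , run′} w≈w′ = state-injective λ x →
    trans (represents run x) (trans (F-cong (≗ᵂ⇒⁻¹ {reverse ks} {reverse ks′} w≈w′ x)) (sym (represents run′ x)))

  to-surjective : ∀ w → ∃ λ x → proj₁ (to x) ≈ᵂ proj₁ w
  to-surjective (w , w∈W) =
    let is , w≈is = generated w
        js , is≗js , adm = admissible-form is (∈W-resp {w} {product is} w≈is w∈W)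
        -- A word acts from its right end, so the letters of `js` are fired in reverse order.
        d , run = admissible⇒run {[]} (reverse js) represents-𝟎
          (≡.subst Admissible (≡.sym (reverse-involutive js)) adm)
    in (d , reverse js , run) , λ x → ≈ᴹ-trans
      (≈ᴹ-reflexive (≡.cong (λ ks → ⟦ ks ⟧ x) (reverse-involutive js)))
      (≈ᴹ-sym (≈ᴹ-trans (w≈is x) (is≗js x)))

  bijection : Bijection reachableSetoid (W^-setoid J)
  bijection = record
    { to        = to
    ; cong      = λ {x} {y} → to-cong {x} {y}
    ; bijective = (λ {x} {y} → to-injective {x} {y}) , λ w →
        let x , to-x≈w = to-surjective w
        in x , λ {y} y≈x z → ≈ᴹ-trans (to-cong {y} {x} y≈x z) (to-x≈w z)
    }
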